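{- Let $n\geq 2$. Consider the following subspaces of the group algebra $\mathbb{Q}[\mathfrak{S}_n]$: \begin{align*} \mathcal{W}^{\pm}&=\mathrm{span}\{W_k^+,W_k^-:1\leq k\leq n-1\},\qquad \mathcal{W}=\mathrm{span}\{W_k:1\leq k\leq n-1\},\qquad \mathcal{W}^\circ=\mathrm{span}\{W_k^\circ:1\leq k\leq n\},\\ \mathcal{C}&=\mathrm{span}\{W_{2k}:1\leq k\leq \lfloor\tfrac{n-1}{2}\rfloor\}\oplus\mathrm{span}\{W_{2k-1}^+,W_{2k-1}^-:1\leq k\leq\lfloor\tfrac n2\rfloor\},\\ \mathcal{P}&=\mathrm{span}\{P_k:0\leq k\leq\lfloor\tfrac{n-1}{2}\rfloor\},\qquad \mathcal{P}^\circ=\mathrm{span}\{P^\circ_k:0\leq k\leq\lfloor\tfrac n2\rfloor\}. \end{align*} Then $\mathcal{W}^{\pm}$ is a subalgebra of the descent algebra $\mathcal{D}_n$, and $\mathcal{W}$, $\mathcal{W}^\circ$, $\mathcal{C}$, $\mathcal{P}$ and $\mathcal{P}^\circ$ are subalgebras of $\mathcal{W}^{\pm}$ (i.e. subspaces of $\mathcal{W}^\pm$ closed under multiplication).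
   Context: Permutations $\sigma\in\mathfrak{S}_n$ are written as words $\sigma_1\cdots\sigma_n$ with $\sigma_i=\sigma(i)$; the product is composition, $(\alpha\beta)(i)=\alpha(\beta(i))$. A descent of $\sigma$ is $i\in[n-1]$ with $\sigma_i>\sigma_{i+1}$; $\mathrm{Des}(\sigma)$ is the set of descents. The descent algebra $\mathcal{D}_n$ is the linear span in $\mathbb{Q}[\mathfrak{S}_n]$ of the elements $\sum_{\mathrm{Des}(\sigma)=I}\sigma$, $I\subseteq[n-1]$ (it is a subalgebra by Solomon's theorem). An alternating run of $\sigma$ is a maximal monotone sequence of consecutive entries of $\sigma_1,\dots,\sigma_n$; $\mathrm{run}(\sigma)$ is their number. A left run is a maximal monotone sequence of consecutive entries of $\sigma_0,\sigma_1,\dots,\sigma_n$ with $\sigma_0=0$; $\mathrm{run}^\circ(\sigma)$ is their number. Let $W_k^+$ (resp. $W_k^-$) be the sum of all $\sigma\in\mathfrak{S}_n$ with $\mathrm{run}(\sigma)=k$ whose first run is ascending, i.e. $\sigma_1<\sigma_2$ (resp. descending); $W_k=W_k^++W_k^-$; $W_k^\circ$ is the sum of all $\sigma$ with $\mathrm{run}^\circ(\sigma)=k$. A peak of $\sigma$ is $i$ with $2\le i\le n-1$ and $\sigma_{i-1}<\sigma_i>\sigma_{i+1}$; a left peak is $i$ with $1\leq i\leq n-1$ and $\sigma_{i-1}<\sigma_i>\sigma_{i+1}$ with the convention $\sigma_0=0$. $P_k$ (resp. $P_k^\circ$) is the sum of all $\sigma\in\mathfrak{S}_n$ with exactly $k$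 peaks (resp. $k$ left peaks). -}

module Defs where

open import Data.Bool using (Bool; true; false; if_then_else_; _∧_; not)
open import Data.Nat using (ℕ; zero; suc; _∸_; _≡ᵇ_; _<ᵇ_; _/_)
open import Data.List using (List; []; _∷_; map; concatMap; filter; length; lookup; _++_)
open import Data.List.Membership.Propositional using (_∈_)
open import Data.Fin using (Fin)
open import Data.Product using (Σ; _×_)
open import Data.Rational using (ℚ; 0ℚ; 1ℚ; _+_; _*_)
open import Relation.Binary.PropositionalEquality using (_≡_)
open import Relation.Nullary.Decidable using (⌊_⌋)
open import Relation.Unary using (Decidable)
open import Data.Bool.Properties using (T?)

-- Permutations of [n] as words σ₁⋯σₙ over {1,…,n}

-- [a, a+1, …, b]  (empty if b < a)
range : ℕ → ℕ → List ℕ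
range a b = go (suc b ∸ a) a
  where
  go : ℕ → ℕ → List ℕ
  go zero    _ = []
  go (suc k) x = x ∷ go k (suc x)

words : ℕ → ℕ → List (List ℕ)
words n zero      = [] ∷ []
words n (suc len) = concatMap (λ a → map (a ∷_) (words n len)) (range 1 n)

memB : ℕ → List ℕ → Bool
memB x []       = false
memB x (y ∷ ys) = if x ≡ᵇ y then true else memB x ys

nodup : List ℕ → Bool
nodup []       = true
nodup (x ∷ xs) = not (memB x xs) ∧ nodup xs

perms : ℕ → List (List ℕ)
perms n = filter (λ w → T? (nodup w)) (words n n)

-- 1-indexed entry of a word (0 outside the range, never used on 𝔖ₙ)
entry : List ℕ → ℕ → ℕ
entry []       _             = 0
entry (x ∷ xs) zero          = 0
entry (x ∷ xs) (suc zero)    = x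
entry (x ∷ xs) (suc (suc i)) = entry xs (suc i)

-- product = composition: (αβ)(i) = α(β(i)), i.e. the word of αβ is α_{β₁}⋯α_{βₙ}
compose : List ℕ → List ℕ → List ℕ
compose α β = map (entry α) β

eqList : List ℕ → List ℕ → Bool
eqList []       []       = true
eqList (x ∷ xs) (y ∷ ys) = (x ≡ᵇ y) ∧ eqList xs ys
eqList _        _        = false

eqBools : List Bool → List Bool → Bool
eqBools []       []       = true
eqBools (x ∷ xs) (y ∷ ys) = (if x then y else not y) ∧ eqBools xs ys
eqBools _        _        = false

-- The group algebra ℚ[𝔖ₙ]: an element is its coefficient function;
-- only its values on perms n are relevant.

Elem : Set
Elem = List ℕ → ℚ

sumL : List ℚ → ℚ
sumL []       = 0ℚ
sumL (x ∷ xs) = x + sumL xs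

mul : ℕ → Elem → Elem → Elem
mul n a b σ =
  sumL (concatMap (λ α → map (λ β → if eqList (compose α β) σ then a α * b β else 0ℚ) (perms n)) (perms n))

sumOf : (List ℕ → Bool) → Elem
sumOf p σ = if p σ then 1ℚ else 0ℚ

sumFin : (m : ℕ) → (Fin m → ℚ) → ℚ
sumFin zero    f = 0ℚ
sumFin (suc m) f = f Fin.zero + sumFin m (λ i → f (Fin.suc i))

InSpan : ℕ → List Elem → Elem → Set
InSpan n G x =
  Σ (Fin (length G) → ℚ) λ c →
    ∀ σ → σ ∈ perms n → x σ ≡ sumFin (length G) (λ i → c i * lookup G i σ)

Included : ℕ → List Elem → List Elem → Set
Included n S T = ∀ x → InSpan n S x → InSpan n T x

MulClosed : ℕ → List Elem → Set
MulClosed n S = ∀ x y → InSpan n S x → InSpan n S y → InSpan n S (mul n x y)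

SubalgebraOf : ℕ → List Elem → List Elem → Set
SubalgebraOf n S T = Included n S T × MulClosed n S

descents : List ℕ → List Bool
descents (x ∷ y ∷ r) = (y <ᵇ x) ∷ descents (y ∷ r)
descents _           = []

blocks : List Bool → ℕ
blocks []            = 0
blocks (x ∷ [])      = 1
blocks (x ∷ y ∷ r)   = (if eqBools (x ∷ []) (y ∷ []) then 0 else 1) Data.Nat.+ blocks (y ∷ r)

-- alternating runs = maximal monotone stretches = maximal blocks of
-- consecutive steps with the same direction (entries are distinct)
run : List ℕ → ℕ
run σ = blocks (descents σ)

runL : List ℕ → ℕ
runL σ = run (0 ∷ σ)

peaks : List ℕ → ℕ
peaks (x ∷ y ∷ z ∷ r) = (if (x <ᵇ y) ∧ (z <ᵇ y) then 1 else 0) Data.Nat.+ peaks (y ∷ z ∷ r)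
peaks _               = 0

peaksL : List ℕ → ℕ
peaksL σ = peaks (0 ∷ σ)

firstAsc : List ℕ → Bool
firstAsc (x ∷ y ∷ _) = x <ᵇ y
firstAsc _           = false

W⁺ W⁻ W W° P P° : ℕ → Elem
W⁺ k = sumOf (λ σ → (run σ ≡ᵇ k) ∧ firstAsc σ)
W⁻ k = sumOf (λ σ → (run σ ≡ᵇ k) ∧ not (firstAsc σ))
W  k = sumOf (λ σ → run σ ≡ᵇ k)
W° k = sumOf (λ σ → runL σ ≡ᵇ k)
P  k = sumOf (λ σ → peaks σ ≡ᵇ k)
P° k = sumOf (λ σ → peaksL σ ≡ᵇ k)

-- all subsets I ⊆ [n-1], as characteristic Bool lists of length n-1
boolLists : ℕ → List (List Bool)
boolLists zero    = [] ∷ []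
boolLists (suc m) = map (true ∷_) (boolLists m) ++ map (false ∷_) (boolLists m)

B : List Bool → Elem
B I = sumOf (λ σ → eqBools (descents σ) I)

genD : ℕ → List Elem
genD n = map B (boolLists (n ∸ 1))

genW± : ℕ → List Elem
genW± n = concatMap (λ k → W⁺ k ∷ W⁻ k ∷ []) (range 1 (n ∸ 1))

genW : ℕ → List Elem
genW n = map W (range 1 (n ∸ 1))

genW° : ℕ → List Elem
genW° n = map W° (range 1 n)

genC : ℕ → List Elem
genC n = map (λ k → W (2 Data.Nat.* k)) (range 1 ((n ∸ 1) / 2))
      ++ concatMap (λ k → W⁺ (2 Data.Nat.* k ∸ 1) ∷ W⁻ (2 Data.Nat.* k ∸ 1) ∷ []) (range 1 (n / 2))

genP : ℕ → List Elem
genP n = map P (range 0 ((n ∸ 1) / 2))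

genP° : ℕ → List Elem
genP° n = map P° (range 0 (n / 2))

{-# OPTIONS --safe #-}
module Submission where

-- For a word ε of signs let X(ε) be the sum of all permutations obtained by dealing the deck 1,…,n
-- onto one pile per letter of ε in all possible ways, turning the piles with a negative sign over,
-- and stacking the piles up. Dealing twice is dealing once: X(ε) X(δ) = X(δ[ε]), where δ[ε] replaces
-- each positive letter of δ by ε and each negative one by the reverse of ε with all signs flipped.
-- (Dealing is a convolution product of coalgebra morphisms for the cocommutative unshuffle coproduct.)
-- Hence the elements A m s = X(s, −s, s, …) with m alternating signs are closed under multiplication:
-- A m s · A k t is A (k m) s for even m and A (k m) (s t) for odd m.
-- The coefficient of σ in A m s counts the ways to cut σ into m factors that are increasing and
-- decreasing as the signs prescribe; a two-term recursion shows that it depends only on the number j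
-- of turns of σ (counted from an initial step of sign s), vanishes for m ≤ j, is a power of two for
-- m = j + 1 and m = j + 2, and takes the same value for j and j + 1 turns if m and j have the same
-- parity. By triangularity the six spaces are therefore spanned as follows: W± by all A m s, W by all
-- A m + + A m −, W° by all A m +, C by the A m s with m odd and the A m + + A m − with m even,
-- P by the A m − with m even, and P° by the A m + with m odd; each family is closed under products.

open import Defs
open import Algebra.Bundles using (CommutativeMonoid; CommutativeSemigroup)
open import Algebra.Core using (Op₁; Op₂)
import Algebra.Properties.CommutativeSemigroup as CommutativeSemigroupProperties
open import Algebra.Structures using (IsCommutativeMonoid; IsCommutativeRing)
open import Data.Bool using (Bool; true; false; not; _xor_; _∧_; _∨_; if_then_else_; T)
open import Data.Bool.Properties using (T?; ∧-identityʳ; ∧-zeroʳ; not-distribˡ-xor; not-distribʳ-xor; not-injective; not-involutive; xor-assoc; xor-identityʳ; xor-same)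
open import Data.Fin using (Fin)
open import Data.List using (List; []; _∷_; [_]; _++_; cartesianProductWith; concatMap; length; lookup; map; reverse)
open import Data.List.Membership.Propositional using (_∈_; _∉_; find; lose)
open import Data.List.Membership.Propositional.Properties using (∈-++⁺ˡ; ∈-++⁺ʳ; ∈-++⁻; ∈-cartesianProductWith⁺; ∈-cartesianProductWith⁻; ∈-concatMap⁺; ∈-concatMap⁻; ∈-filter⁺; ∈-filter⁻; ∈-map⁺; ∈-map⁻; ∈-∃++)
open import Data.List.Properties using (++-assoc; ++-identityʳ; ∷-injective; map-++; reverse-++; reverse-involutive; reverse-map; unfold-reverse)
open import Data.List.Relation.Binary.Permutation.Propositional using (_↭_; prep; ↭-refl; ↭-sym; ↭-trans; ↭⇒↭ₛ)
open import Data.List.Relation.Binary.Permutation.Propositional.Properties using (++⁺; ++⁺ʳ; ++⁺ˡ; All-resp-↭; drop-∷; shift; ¬x∷xs↭[]; ↭-length; ↭-reverse; ∈-resp-↭)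
import Data.List.Relation.Binary.Permutation.Setoid.Properties as Permutation
open import Data.List.Relation.Ternary.Interleaving.Propositional using (Interleaving; []; consʳ; consˡ; toPermutation)
open import Data.List.Relation.Unary.All as All using (All; []; _∷_)
import Data.List.Relation.Unary.All.Properties as All
open import Data.List.Relation.Unary.AllPairs as AllPairs using (AllPairs; []; _∷_)
import Data.List.Relation.Unary.AllPairs.Properties as AllPairs
open import Data.List.Relation.Unary.Any as Any using (Any; here; there)
open import Data.List.Relation.Unary.Linked using (Linked; []; [-]; _∷_)
open import Data.List.Relation.Unary.Linked.Properties using (AllPairs⇒Linked; Linked⇒AllPairs)
open import Data.List.Relation.Unary.Unique.Propositional using (Unique)
import Data.List.Relation.Unary.Unique.Propositional.Properties as Unique
open import Data.Nat as ℕ using (ℕ; zero; suc; z≤n; s≤s; _/_; _<_; _<ᵇ_; _>_; _≟_; _≡ᵇ_; _≤_; _∸_; ⌊_/2⌋)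
open import Data.Nat.DivMod using (/-monoˡ-≤; m*n/n≡m)
import Data.Nat.Properties as ℕ
open import Data.Product using (_×_; _,_; proj₁; proj₂; ∃; ∃₂)
open import Data.Rational using (ℚ; 0ℚ; 1ℚ; ½; _+_; _*_)
import Data.Rational.Properties as ℚ
open import Data.Sum using (_⊎_; inj₁; inj₂)
open import Data.Unit using (tt)
open import Function using (flip)
open import Relation.Binary.PropositionalEquality using (_≡_; _≢_; cong; cong₂; refl; setoid; subst; sym; trans; module ≡-Reasoning)
open import Relation.Nullary using (contradiction; ¬_; yes; no)

open ≡-Reasoning

-- Boolean tests and order facts on lists

T⇒≡true : ∀ {b} → T b → b ≡ true
T⇒≡true {true} _ = refl

≡true⇒T : ∀ {b} → b ≡ true → T b
≡true⇒T refl = tt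

≡ᵇ-refl : ∀ m → (m ≡ᵇ m) ≡ true
≡ᵇ-refl m = T⇒≡true (ℕ.≡⇒≡ᵇ m m refl)

≡ᵇ-sound : ∀ m n → (m ≡ᵇ n) ≡ true → m ≡ n
≡ᵇ-sound m n e = ℕ.≡ᵇ⇒≡ m n (≡true⇒T e)

eqList-refl : ∀ w → eqList w w ≡ true
eqList-refl []      = refl
eqList-refl (x ∷ w) rewrite ≡ᵇ-refl x = eqList-refl w

eqList-sound : ∀ u w → eqList u w ≡ true → u ≡ w
eqList-sound []      []      e = refl
eqList-sound (x ∷ u) (y ∷ w) e with x ≡ᵇ y in x≡y
... | true = cong₂ _∷_ (≡ᵇ-sound x y x≡y) (eqList-sound u w e)

AllPairs-reverse : ∀ {A : Set} {R : A → A → Set} {a} → AllPairs R a → AllPairs (flip R) (reverse a)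
AllPairs-reverse [] = []
AllPairs-reverse {R = R} {x ∷ a} (px ∷ pa) = subst (AllPairs (flip R)) (sym (unfold-reverse x a))
  (AllPairs.++⁺ (AllPairs-reverse pa) ([] ∷ [])
    (All.map (λ r → r ∷ []) (All-resp-↭ (↭-sym (↭-reverse a)) px)))

Interleaving-All : ∀ {A : Set} {P : A → Set} {u v L : List A} → Interleaving u v L → All P L → All P u
Interleaving-All []        []         = []
Interleaving-All (consˡ i) (px ∷ pxs) = px ∷ Interleaving-All i pxs
Interleaving-All (consʳ i) (px ∷ pxs) = Interleaving-All i pxs

Interleaving-AllPairs : ∀ {A : Set} {R : A → A → Set} {u v L : List A} →
                        Interleaving u v L → AllPairs R L → AllPairs R u
Interleaving-AllPairs []        []         = []
Interleaving-AllPairs (consˡ i) (px ∷ pxs) = Interleaving-All i px ∷ Interleaving-AllPairs i pxs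
Interleaving-AllPairs (consʳ i) (px ∷ pxs) = Interleaving-AllPairs i pxs

-- Signed steps and words of signs

Step : Bool → ℕ → ℕ → Set
Step false = _<_
Step true  = _>_

Step-trans : ∀ s {x y z} → Step s x y → Step s y z → Step s x z
Step-trans false = ℕ.<-trans
Step-trans true  p q = ℕ.<-trans q p

step? : ∀ s {x y} → x ≢ y → ((y <ᵇ x) xor s ≡ false × Step s x y) ⊎ ((y <ᵇ x) xor s ≡ true × ¬ Step s x y)
step? s {x} {y} x≢y with y <ᵇ x in e
step? true  {x} {y} x≢y | true  = inj₁ (refl , ℕ.<ᵇ⇒< y x (≡true⇒T e))
step? false {x} {y} x≢y | true  = inj₂ (refl , ℕ.<-asym (ℕ.<ᵇ⇒< y x (≡true⇒T e)))
step? true  {x} {y} x≢y | false = inj₂ (refl , λ y<x → subst T e (ℕ.<⇒<ᵇ y<x))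
step? false {x} {y} x≢y | false = inj₁ (refl , ℕ.≤∧≢⇒< (ℕ.≮⇒≥ (λ y<x → subst T e (ℕ.<⇒<ᵇ y<x))) x≢y)

-- Branches on `d xor s`, with `d` the descent bit of a step, exactly as `turns` and `altCuts` do,
-- so that counts of cuts can be read off the list of descents.
monotone : Bool → List ℕ → Bool
monotone s []          = true
monotone s (x ∷ [])    = true
monotone s (x ∷ y ∷ w) = if (y <ᵇ x) xor s then false else monotone s (y ∷ w)

monotone? : ∀ s a → Unique a →
  (monotone s a ≡ true × Linked (Step s) a) ⊎ (monotone s a ≡ false × ¬ Linked (Step s) a)
monotone? s []          _ = inj₁ (refl , [])
monotone? s (x ∷ [])    _ = inj₁ (refl , [-])
monotone? s (x ∷ y ∷ a) ((x≢y ∷ _) ∷ a!) with step? s x≢y | monotone? s (y ∷ a) a!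
... | inj₁ (e , p) | inj₁ (e′ , q) rewrite e = inj₁ (e′ , p ∷ q)
... | inj₁ (e , p) | inj₂ (e′ , q) rewrite e = inj₂ (e′ , λ { (_ ∷ r) → q r })
... | inj₂ (e , p) | _             rewrite e = inj₂ (refl , λ { (r ∷ _) → p r })

flipReverse : List Bool → List Bool
flipReverse []      = []
flipReverse (s ∷ ε) = flipReverse ε ++ [ not s ]

-- `concatMap (block ε) δ` is the substitution δ[ε].
block : List Bool → Bool → List Bool
block ε false = ε
block ε true  = flipReverse ε

alternating : ℕ → Bool → List Bool
alternating zero    s = []
alternating (suc m) s = s ∷ alternating m (not s)

turns : Bool → List Bool → ℕ
turns s []       = 0
turns s (d ∷ ds) = if d xor s then suc (turns d ds) else turns d ds

odd : ℕ → Bool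
odd zero    = false
odd (suc m) = not (odd m)

odd-2+ : ∀ m {b} → odd (suc (suc m)) ≡ b → odd m ≡ b
odd-2+ m e = trans (sym (not-involutive (odd m))) e

-- Permutations as words

interval : ℕ → ℕ → List ℕ
interval a zero    = []
interval a (suc k) = a ∷ interval (suc a) k

-- rangeGo is solved to be the local recursion inside range, which has no name of its own.
mutual
  rangeGo : ℕ → ℕ → ℕ → ℕ → List ℕ
  rangeGo = _

  rangeGo-interval : ∀ a b k x → rangeGo a b k x ≡ interval x k
  rangeGo-interval a b zero    x = refl
  rangeGo-interval a b (suc k) x = cong (x ∷_) (rangeGo-interval a b k (suc x))

  range-interval : ∀ a b → range a b ≡ interval a (suc b ∸ a)
  range-interval a b with suc b ∸ a
  ... | zero  = refl
  ... | suc k with suc a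
  -- With `suc a` generalised to `y`, `rangeGo` is applied to distinct variables and the equation
  -- determines it.
  ...   | y = cong (a ∷_) (rangeGo-interval a b k y)

∈-interval : ∀ {a k x} → a ≤ x → x < a ℕ.+ k → x ∈ interval a k
∈-interval {a} {zero}  {x} a≤x x<a = contradiction a≤x (ℕ.<⇒≱ (subst (x <_) (ℕ.+-identityʳ a) x<a))
∈-interval {a} {suc k} {x} a≤x x<a with ℕ.m≤n⇒m<n∨m≡n a≤x
... | inj₂ refl = here refl
... | inj₁ a<x  = there (∈-interval a<x (subst (x <_) (ℕ.+-suc a k) x<a))

∈-range : ∀ {a b x} → a ≤ x → x ≤ b → x ∈ range a b
∈-range {a} {b} {x} a≤x x≤b = subst (x ∈_) (sym (range-interval a b))
  (∈-interval a≤x (subst (x <_) (sym (ℕ.m+[n∸m]≡n (ℕ.≤-trans a≤x (ℕ.m≤n⇒m≤1+n x≤b)))) (s≤s x≤b)))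

interval-≥ : ∀ {a b} k → a ≤ b → All (a ≤_) (interval b k)
interval-≥ zero    a≤b = []
interval-≥ (suc k) a≤b = a≤b ∷ interval-≥ k (ℕ.m≤n⇒m≤1+n a≤b)

interval-sorted : ∀ a k → AllPairs _<_ (interval a k)
interval-sorted a zero    = []
interval-sorted a (suc k) = interval-≥ k ℕ.≤-refl ∷ interval-sorted (suc a) k

interval-length : ∀ a k → length (interval a k) ≡ k
interval-length a zero    = refl
interval-length a (suc k) = cong suc (interval-length (suc a) k)

range-≥ : ∀ {a b x} → x ∈ range a b → a ≤ x
range-≥ {a} {b} x∈ = All.lookup (interval-≥ (suc b ∸ a) ℕ.≤-refl) (subst (_ ∈_) (range-interval a b) x∈)

-- The deck `α` is the deck 1,...,n relabelled by `entry α`. This is how left multiplication by `α`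
-- becomes a relabelling of cards.
map-entry : ∀ α → map (entry α) (interval 1 (length α)) ≡ α
map-entry []      = refl
map-entry (x ∷ α) = cong (x ∷_) (trans (shifted 0 (length α)) (map-entry α))
  where
  shifted : ∀ a k → map (entry (x ∷ α)) (interval (2 ℕ.+ a) k) ≡ map (entry α) (interval (1 ℕ.+ a) k)
  shifted a zero    = refl
  shifted a (suc k) = cong (_ ∷_) (shifted (suc a) k)

memB-∈ : ∀ {x ys} → memB x ys ≡ true → x ∈ ys
memB-∈ {x} {y ∷ ys} e with x ≡ᵇ y in x≡y
... | true  = here (≡ᵇ-sound x y x≡y)
... | false = there (memB-∈ e)

∈-memB : ∀ {x ys} → x ∈ ys → memB x ys ≡ true
∈-memB {x} {y ∷ ys} (here refl) rewrite ≡ᵇ-refl x = refl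
∈-memB {x} {y ∷ ys} (there x∈ys) with x ≡ᵇ y
... | true  = refl
... | false = ∈-memB x∈ys

nodup-Unique : ∀ w → T (nodup w) → Unique w
nodup-Unique []      _ = []
nodup-Unique (x ∷ w) t with memB x w in e
... | false = All.tabulate (λ y∈w x≡y →
  contradiction (trans (sym e) (∈-memB (subst (_∈ w) (sym x≡y) y∈w))) λ ()) ∷ nodup-Unique w t

Unique-nodup : ∀ {w} → Unique w → T (nodup w)
Unique-nodup {[]}    []        = _
Unique-nodup {x ∷ w} (x∉w ∷ w!) with memB x w in e
... | true  = All.lookup x∉w (memB-∈ e) refl
... | false = Unique-nodup w!

-- In the form of a cartesian product, `words` gets membership and uniqueness from general facts.
concatMap-cartesianProductWith : ∀ {A B C : Set} (f : A → B → C) xs ys →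
  concatMap (λ a → map (f a) ys) xs ≡ cartesianProductWith f xs ys
concatMap-cartesianProductWith f []       ys = refl
concatMap-cartesianProductWith f (x ∷ xs) ys = cong (map (f x) ys ++_) (concatMap-cartesianProductWith f xs ys)

words-suc : ∀ n len → words n (suc len) ≡ cartesianProductWith _∷_ (range 1 n) (words n len)
words-suc n len = concatMap-cartesianProductWith _∷_ (range 1 n) (words n len)

∈-words⁺ : ∀ {n} w → All (_∈ range 1 n) w → w ∈ words n (length w)
∈-words⁺         []      []       = here refl
∈-words⁺ {n} (x ∷ w) (p ∷ ps) =
  subst (_ ∈_) (sym (words-suc n (length w))) (∈-cartesianProductWith⁺ _∷_ p (∈-words⁺ w ps))

∈-words⁻ : ∀ n len {w} → w ∈ words n len → length w ≡ len × All (_∈ range 1 n) w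
∈-words⁻ n zero      (here refl) = refl , []
∈-words⁻ n (suc len) w∈
  with ∈-cartesianProductWith⁻ _∷_ (range 1 n) (words n len) (subst (_ ∈_) (words-suc n len) w∈)
... | a , w , a∈ , w∈′ , refl with ∈-words⁻ n len w∈′
...   | e , p = cong suc e , a∈ ∷ p

words-Unique : ∀ n len → Unique (words n len)
words-Unique n zero      = [] ∷ []
words-Unique n (suc len) = subst Unique (sym (words-suc n len))
  (Unique.cartesianProductWith⁺ _∷_ ∷-injective
    (subst Unique (sym (range-interval 1 n)) (AllPairs.map ℕ.<⇒≢ (interval-sorted 1 n))) (words-Unique n len))

perms-Unique : ∀ n → Unique (perms n)
perms-Unique n = Unique.filter⁺ (λ w → T? (nodup w)) (words-Unique n n)

-- Pigeonhole principle: the head of `xs` is removed from `ys` where it occurs, and by uniqueness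
-- the tail stays inside what remains.
Unique∧⊆⇒↭ : ∀ {A : Set} {xs ys : List A} → Unique xs → All (_∈ ys) xs → length xs ≡ length ys → xs ↭ ys
Unique∧⊆⇒↭ {ys = []}    []         []       e = ↭-refl
Unique∧⊆⇒↭ {xs = x ∷ xs} (x∉ ∷ xs!) (p ∷ ps) e with ∈-∃++ p
... | ys₁ , ys₂ , refl = ↭-trans
  (prep x (Unique∧⊆⇒↭ xs! (All.zipWith (λ (x≢z , z∈) → drop x≢z (∈-resp-↭ (shift x ys₁ ys₂) z∈)) (x∉ , ps))
    (ℕ.suc-injective (trans e (↭-length (shift x ys₁ ys₂))))))
  (↭-sym (shift x ys₁ ys₂))
  where
  drop : ∀ {z l} → x ≢ z → z ∈ x ∷ l → z ∈ l
  drop x≢z (here z≡x)  = contradiction (sym z≡x) x≢z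
  drop x≢z (there z∈l) = z∈l

perms-Unique-word : ∀ {n σ} → σ ∈ perms n → Unique σ
perms-Unique-word {n} {σ} σ∈ = nodup-Unique σ (proj₂ (∈-filter⁻ (λ w → T? (nodup w)) {xs = words n n} σ∈))

perms-length : ∀ {n σ} → σ ∈ perms n → length σ ≡ n
perms-length {n} σ∈ = proj₁ (∈-words⁻ n n (proj₁ (∈-filter⁻ (λ w → T? (nodup w)) {xs = words n n} σ∈)))

-- Together with the converse below, this replaces the enumeration `perms n` by the rearrangements
-- of 1,...,n, which are what dealing produces.
perms⇒↭ : ∀ {n σ} → σ ∈ perms n → σ ↭ interval 1 n
perms⇒↭ {n} {σ} σ∈ = Unique∧⊆⇒↭ (perms-Unique-word {n} σ∈)
  (subst (λ l → All (_∈ l) σ) (range-interval 1 n)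
    (proj₂ (∈-words⁻ n n (proj₁ (∈-filter⁻ (λ w → T? (nodup w)) {xs = words n n} σ∈)))))
  (trans (perms-length {n} σ∈) (sym (interval-length 1 n)))

↭⇒perms : ∀ {n σ} → σ ↭ interval 1 n → σ ∈ perms n
↭⇒perms {n} {σ} p = ∈-filter⁺ (λ w → T? (nodup w))
  (subst (λ k → σ ∈ words n k) (trans (↭-length p) (interval-length 1 n))
    (∈-words⁺ σ (All-resp-↭ (↭-sym p)
      (subst (λ l → All (_∈ l) (interval 1 n)) (sym (range-interval 1 n)) (All.tabulate (λ z → z))))))
  (Unique-nodup (Permutation.Unique-resp-↭ (setoid ℕ) (↭⇒↭ₛ (↭-sym p)) (AllPairs.map ℕ.<⇒≢ (interval-sorted 1 n))))

-- Substitution into alternating words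

xor-not : ∀ s o → s xor not o ≡ not s xor o
xor-not s o = trans (sym (not-distribʳ-xor s o)) (not-distribˡ-xor s o)

xor-cancelʳ : ∀ s o → (s xor o) xor o ≡ s
xor-cancelʳ s o = trans (xor-assoc s o o) (trans (cong (s xor_) (xor-same o)) (xor-identityʳ s))

-- The hypothesis makes the second word take up where the first stops: after `a` letters the sign
-- has flipped `a` times.
alternating-++ : ∀ a b s t → t ≡ s xor odd a →
                 alternating a s ++ alternating b t ≡ alternating (a ℕ.+ b) s
alternating-++ zero    b s t e = cong (alternating b) (trans e (xor-identityʳ s))
alternating-++ (suc a) b s t e = cong (s ∷_) (alternating-++ a b (not s) t (trans e (xor-not s (odd a))))

-- The new first sign is the flipped last one, that is `s` flipped `m` times.
flipReverse-alternating : ∀ m s → flipReverse (alternating m s) ≡ alternating m (s xor odd m)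
flipReverse-alternating zero    s = refl
flipReverse-alternating (suc m) s = begin
  flipReverse (alternating m (not s)) ++ [ not s ]
    ≡⟨ cong (_++ [ not s ]) (flipReverse-alternating m (not s)) ⟩
  alternating m (not s xor odd m) ++ alternating 1 (not s)
    ≡⟨ alternating-++ m 1 (not s xor odd m) (not s) (sym (xor-cancelʳ (not s) (odd m))) ⟩
  alternating (m ℕ.+ 1) (not s xor odd m)
    ≡⟨ cong₂ alternating (ℕ.+-comm m 1) (sym (xor-not s (odd m))) ⟩
  alternating (suc m) (s xor not (odd m)) ∎

-- A word of even length is its own flipped reverse, so `t` has an effect for odd `m` only.
block-alternating : ∀ m s t → block (alternating m s) t ≡ alternating m (s xor (odd m ∧ t))
block-alternating m s true  = trans (flipReverse-alternating m s)
  (cong (λ o → alternating m (s xor o)) (sym (∧-identityʳ (odd m))))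
block-alternating m s false =
  cong (alternating m) (sym (trans (cong (s xor_) (∧-zeroʳ (odd m))) (xor-identityʳ s)))

blocks-alternating : ∀ m s k t →
  concatMap (block (alternating m s)) (alternating k t) ≡ alternating (k ℕ.* m) (s xor (odd m ∧ t))
blocks-alternating m s zero    t = refl
blocks-alternating m s (suc k) t = trans
  (cong₂ _++_ (block-alternating m s t) (blocks-alternating m s k (not t)))
  (alternating-++ m (k ℕ.* m) _ _ (begin
    -- From one block to the next the outer sign flips, which moves the first sign of the block by
    -- `odd m`. A block of `m` letters needs just this shift to be continued without a break.
    s xor (odd m ∧ not t)         ≡⟨ cong (s xor_) (next (odd m) t) ⟩
    s xor ((odd m ∧ t) xor odd m) ≡⟨ xor-assoc s (odd m ∧ t) (odd m) ⟨
    (s xor (odd m ∧ t)) xor odd m ∎))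
  where
  next : ∀ o t → o ∧ not t ≡ (o ∧ t) xor o
  next false t     = refl
  next true  false = refl
  next true  true  = refl

-- Runs, peaks and turns

blocks-turns : ∀ s ds → blocks (s ∷ ds) ≡ suc (turns s ds)
blocks-turns s     []           = refl
blocks-turns false (false ∷ ds) = blocks-turns false ds
blocks-turns false (true ∷ ds)  = cong suc (blocks-turns true ds)
blocks-turns true  (false ∷ ds) = cong suc (blocks-turns false ds)
blocks-turns true  (true ∷ ds)  = blocks-turns true ds

turns-≤ : ∀ s ds → turns s ds ≤ length ds
turns-≤ s     []       = z≤n
turns-≤ s     (d ∷ ds) with d xor s
... | true  = s≤s (turns-≤ d ds)
... | false = ℕ.m≤n⇒m≤1+n (turns-≤ d ds)

length-descents : ∀ x w → length (descents (x ∷ w)) ≡ length w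
length-descents x []      = refl
length-descents x (y ∷ w) = cong suc (length-descents y w)

<ᵇ-flip : ∀ {x y} → x ≢ y → (x <ᵇ y) ≡ not (y <ᵇ x)
<ᵇ-flip {zero}  {zero}  x≢y with () ← x≢y refl
<ᵇ-flip {zero}  {suc y} x≢y = refl
<ᵇ-flip {suc x} {zero}  x≢y = refl
<ᵇ-flip {suc x} {suc y} x≢y = <ᵇ-flip {x} {y} (λ x≡y → x≢y (cong suc x≡y))

-- The turns, counted from sign `s`, of a permutation with `r` runs, the first one ascending if `b`
-- is true. If `b xor s` holds, the first run goes in direction `s` and there are `r − 1` turns;
-- otherwise the start is one more.
turnsFrom : ℕ → Bool → Bool → ℕ
turnsFrom r b s = if b xor s then r ∸ 1 else r

turns-run : ∀ {x y w} → x ≢ y → ∀ s → let σ = x ∷ y ∷ w in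
            turns s (descents σ) ≡ turnsFrom (run σ) (firstAsc σ) s
turns-run {x} {y} {w} x≢y s
  rewrite <ᵇ-flip x≢y | blocks-turns (y <ᵇ x) (descents (y ∷ w)) = cases (y <ᵇ x) s
  where
  cases : ∀ d s → let t = turns d (descents (y ∷ w)) in
          (if d xor s then suc t else t) ≡ (if not d xor s then t else suc t)
  cases false false = refl
  cases false true  = refl
  cases true  false = refl
  cases true  true  = refl

ascDesc : List Bool → ℕ
ascDesc (d ∷ e ∷ ds) = (if not d ∧ e then 1 else 0) ℕ.+ ascDesc (e ∷ ds)
ascDesc _            = 0

peaks-ascDesc : ∀ σ → Unique σ → peaks σ ≡ ascDesc (descents σ)
peaks-ascDesc []              _ = refl
peaks-ascDesc (x ∷ [])        _ = refl
peaks-ascDesc (x ∷ y ∷ [])    _ = refl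
peaks-ascDesc (x ∷ y ∷ z ∷ w) ((x≢y ∷ _) ∷ σ!) = cong₂ ℕ._+_
  (cong (λ b → if b ∧ (z <ᵇ y) then 1 else 0) (<ᵇ-flip x≢y)) (peaks-ascDesc (y ∷ z ∷ w) σ!)

ascDesc-true : ∀ ds → ascDesc (true ∷ ds) ≡ ascDesc ds
ascDesc-true []       = refl
ascDesc-true (d ∷ ds) = refl

mutual
  -- Turns alternate between valleys and peaks. Counted from a descent the first turn is a valley,
  -- counted from an ascent it is a peak; this decides how the half is rounded.
  ascDesc-turns-true : ∀ ds → ascDesc (true ∷ ds) ≡ ⌊ turns true ds /2⌋
  ascDesc-turns-true []           = refl
  ascDesc-turns-true (false ∷ ds) = ascDesc-turns-false ds
  ascDesc-turns-true (true ∷ ds)  = ascDesc-turns-true ds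

  ascDesc-turns-false : ∀ ds → ascDesc (false ∷ ds) ≡ ⌊ suc (turns false ds) /2⌋
  ascDesc-turns-false []           = refl
  ascDesc-turns-false (false ∷ ds) = ascDesc-turns-false ds
  ascDesc-turns-false (true ∷ ds)  = cong suc (ascDesc-turns-true ds)

-- Unfolds two successors at a time, as do `⌊_/2⌋`, `straight` and `turning`.
double : ℕ → ℕ
double zero    = zero
double (suc k) = suc (suc (double k))

odd-double : ∀ k → odd (double k) ≡ false
odd-double zero    = refl
odd-double (suc k) = cong (λ b → not (not b)) (odd-double k)

⌊double/2⌋ : ∀ k → ⌊ double k /2⌋ ≡ k
⌊double/2⌋ zero    = refl
⌊double/2⌋ (suc k) = cong suc (⌊double/2⌋ k)

⌊1+double/2⌋ : ∀ k → ⌊ suc (double k) /2⌋ ≡ k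
⌊1+double/2⌋ zero    = refl
⌊1+double/2⌋ (suc k) = cong suc (⌊1+double/2⌋ k)

data HalfView : ℕ → Set where
  isEven : ∀ k → HalfView (double k)
  isOdd  : ∀ k → HalfView (suc (double k))

halfView : ∀ t → HalfView t
halfView zero          = isEven zero
halfView (suc zero)    = isOdd zero
halfView (suc (suc t)) with halfView t
... | isEven k = isEven (suc k)
... | isOdd  k = isOdd (suc k)

odd-+ : ∀ a b → odd (a ℕ.+ b) ≡ odd a xor odd b
odd-+ zero    b = refl
odd-+ (suc a) b = trans (cong not (odd-+ a b)) (not-distribˡ-xor (odd a) (odd b))

odd-* : ∀ k m → odd (k ℕ.* m) ≡ odd k ∧ odd m
odd-* zero    m = refl
odd-* (suc k) m = trans (odd-+ m (k ℕ.* m)) (trans (cong (odd m xor_) (odd-* k m)) (distr (odd m) (odd k)))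
  where
  distr : ∀ m k → m xor (k ∧ m) ≡ not k ∧ m
  distr false false = refl
  distr false true  = refl
  distr true  false = refl
  distr true  true  = refl

perms-Unique-0∷ : ∀ {n σ} → σ ∈ perms n → Unique (0 ∷ σ)
perms-Unique-0∷ {n} σ∈ =
  All.map ℕ.<⇒≢ (All-resp-↭ (↭-sym (perms⇒↭ {n} σ∈)) (interval-≥ n ℕ.≤-refl)) ∷ perms-Unique-word {n} σ∈

-- A descent put in front creates no peak, so peaks may be counted from the sign -. For left peaks,
-- below, the letter 0 supplies an initial ascent and the sign is +.
perms-peaks : ∀ {n σ} → σ ∈ perms n → peaks σ ≡ ⌊ turns true (descents σ) /2⌋
perms-peaks {n} {σ} σ∈ = trans (peaks-ascDesc σ (perms-Unique-word {n} σ∈))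
  (trans (sym (ascDesc-true (descents σ))) (ascDesc-turns-true (descents σ)))

module _ {n M : ℕ} (n≡2+M : n ≡ suc (suc M)) {σ} (σ∈ : σ ∈ perms n) where

  private
    view : ∀ {σ : List ℕ} → length σ ≡ suc (suc M) → ∃₂ λ x y → ∃ λ w → σ ≡ x ∷ y ∷ w × length w ≡ M
    view {x ∷ y ∷ w} e = x , y , w , refl , ℕ.suc-injective (ℕ.suc-injective e)

    perms-view : ∃₂ λ x y → ∃ λ w → σ ≡ x ∷ y ∷ w × length w ≡ M
    perms-view = view (trans (perms-length {n} σ∈) n≡2+M)

  perms-length-descents : length (descents σ) ≡ suc M
  perms-length-descents with perms-view
  ... | x , y , w , refl , e = cong suc (trans (length-descents y w) e)

  perms-turns-≤ : ∀ s → turns s (descents σ) ≤ suc M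
  perms-turns-≤ s = subst (turns s (descents σ) ≤_) perms-length-descents (turns-≤ s (descents σ))

  perms-turns-run : ∀ s → turns s (descents σ) ≡ turnsFrom (run σ) (firstAsc σ) s
  perms-turns-run s with perms-view | perms-Unique-word {n} σ∈
  ... | x , y , w , refl , e | (x≢y ∷ _) ∷ _ = turns-run {w = w} x≢y s

  perms-run-≥ : 1 ≤ run σ
  perms-run-≥ with perms-view
  ... | x , y , w , refl , e = subst (1 ≤_) (sym (blocks-turns (y <ᵇ x) (descents (y ∷ w)))) (s≤s z≤n)

  perms-run-≤ : run σ ≤ suc M
  perms-run-≤ with perms-view
  ... | x , y , w , refl , e = subst (_≤ suc M) (sym (blocks-turns (y <ᵇ x) (descents (y ∷ w))))
    (s≤s (subst (turns (y <ᵇ x) (descents (y ∷ w)) ≤_) (trans (length-descents y w) e) (turns-≤ (y <ᵇ x) (descents (y ∷ w)))))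

  perms-runL : runL σ ≡ suc (turns false (descents σ))
  perms-runL with perms-view
  ... | x , y , w , refl , e = blocks-turns false (descents (x ∷ y ∷ w))

  perms-peaksL : peaksL σ ≡ ⌊ suc (turns false (descents σ)) /2⌋
  perms-peaksL with perms-view | peaks-ascDesc (0 ∷ σ) (perms-Unique-0∷ {n} σ∈)
  ... | x , y , w , refl , _ | e = trans e (ascDesc-turns-false (descents σ))

double-mono : ∀ {k l} → k ≤ l → double k ≤ double l
double-mono z≤n       = z≤n
double-mono (s≤s k≤l) = s≤s (s≤s (double-mono k≤l))

odd-*-even : ∀ k m → odd m ≡ false → odd (k ℕ.* m) ≡ false
odd-*-even k m m-even = trans (odd-* k m) (trans (cong (odd k ∧_) m-even) (∧-zeroʳ (odd k)))

-- Dealing cards onto signed piles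

module Dealing {R : Set} {_+_ _*_ : Op₂ R} { -_ : Op₁ R } {0# 1# : R}
               (isCommutativeRing : IsCommutativeRing _≡_ _+_ _*_ -_ 0# 1#) where

  open IsCommutativeRing isCommutativeRing
    using ( +-isCommutativeMonoid; +-assoc; +-comm; +-identityˡ; +-identityʳ; +-congˡ; +-congʳ; -‿inverseʳ
          ; *-assoc; *-comm; *-identityˡ; *-identityʳ; *-congˡ; *-congʳ; distribˡ; distribʳ; zeroˡ; zeroʳ )

  private
    +-commutativeSemigroup : CommutativeSemigroup _ _
    +-commutativeSemigroup = record
      { isCommutativeSemigroup = IsCommutativeMonoid.isCommutativeSemigroup +-isCommutativeMonoid }

  open CommutativeSemigroupProperties +-commutativeSemigroup using (interchange; xy∙z≈xz∙y)

  module _ {A : Set} where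

    -- A multiset of decks is encoded by the functional that sums a test function (ψ or φ) over it.
    unshuffle : (List A → List A → R) → List A → R
    unshuffle ψ []      = ψ [] []
    unshuffle ψ (x ∷ L) = unshuffle (λ u v → ψ (x ∷ u) v) L + unshuffle (λ u v → ψ u (x ∷ v)) L

    unshuffle-cong : ∀ {ψ ψ′} L → (∀ {u v} → Interleaving u v L → ψ u v ≡ ψ′ u v) →
                     unshuffle ψ L ≡ unshuffle ψ′ L
    unshuffle-cong []      h = h []
    unshuffle-cong (x ∷ L) h =
      cong₂ _+_ (unshuffle-cong L (λ i → h (consˡ i))) (unshuffle-cong L (λ i → h (consʳ i)))

    unshuffle-cong′ : ∀ {ψ ψ′} L → (∀ u v → ψ u v ≡ ψ′ u v) → unshuffle ψ L ≡ unshuffle ψ′ L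
    unshuffle-cong′ L h = unshuffle-cong L (λ {u} {v} _ → h u v)

    unshuffle-0 : ∀ L → unshuffle (λ _ _ → 0#) L ≡ 0#
    unshuffle-0 []      = refl
    unshuffle-0 (x ∷ L) = trans (cong₂ _+_ (unshuffle-0 L) (unshuffle-0 L)) (+-identityˡ 0#)

    unshuffle-≡0 : ∀ {ψ} L → (∀ {u v} → Interleaving u v L → ψ u v ≡ 0#) → unshuffle ψ L ≡ 0#
    unshuffle-≡0 L h = trans (unshuffle-cong L h) (unshuffle-0 L)

    unshuffle-+ : ∀ ψ ψ′ L →
                  unshuffle (λ u v → ψ u v + ψ′ u v) L ≡ unshuffle ψ L + unshuffle ψ′ L
    unshuffle-+ ψ ψ′ []      = refl
    unshuffle-+ ψ ψ′ (x ∷ L) =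
      trans (cong₂ _+_ (unshuffle-+ _ _ L) (unshuffle-+ _ _ L)) (interchange _ _ _ _)

    unshuffle-*ʳ : ∀ ψ c L → unshuffle (λ u v → ψ u v * c) L ≡ unshuffle ψ L * c
    unshuffle-*ʳ ψ c []      = refl
    unshuffle-*ʳ ψ c (x ∷ L) =
      trans (cong₂ _+_ (unshuffle-*ʳ _ c L) (unshuffle-*ʳ _ c L)) (sym (distribʳ c _ _))

    -- Interchange of finite sums, where `Λ` is an additive functional such as `deal ε` on a fixed
    -- deck. Additivity is enough because `unshuffle` never is an empty sum.
    unshuffle-swap : ∀ {B : Set} (Λ : (B → R) → R) →
                     (∀ f g → Λ (λ b → f b + g b) ≡ Λ f + Λ g) →
                     ∀ (g : List A → List A → B → R) L → unshuffle (λ u v → Λ (g u v)) L ≡ Λ (λ b → unshuffle (λ u v → g u v b) L)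
    unshuffle-swap Λ Λ-+ g []      = refl
    unshuffle-swap Λ Λ-+ g (x ∷ L) =
      trans (cong₂ _+_ (unshuffle-swap Λ Λ-+ _ L) (unshuffle-swap Λ Λ-+ _ L)) (sym (Λ-+ _ _))

    -- Cocommutativity.
    unshuffle-comm : ∀ ψ L → unshuffle (λ u v → ψ v u) L ≡ unshuffle ψ L
    unshuffle-comm ψ []      = refl
    unshuffle-comm ψ (x ∷ L) =
      trans (cong₂ _+_ (unshuffle-comm _ L) (unshuffle-comm _ L)) (+-comm _ _)

    -- Coassociativity: both sides spread `L` over three piles, and the three summands say where the
    -- first card goes.
    unshuffle-assoc : ∀ (g : List A → List A → List A → R) L →
      unshuffle (λ u v → unshuffle (λ v₁ v₂ → g u v₁ v₂) v) L
      ≡ unshuffle (λ u v → unshuffle (λ u₁ u₂ → g u₁ u₂ v) u) L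
    unshuffle-assoc g []      = refl
    unshuffle-assoc g (x ∷ L) = begin
      _ + unshuffle (λ u v → _ + _) L
        ≡⟨ cong₂ _+_ (unshuffle-assoc _ L)
             (trans (unshuffle-+ _ _ L) (cong₂ _+_ (unshuffle-assoc _ L) (unshuffle-assoc _ L))) ⟩
      _ + (_ + _)
        ≡⟨ +-assoc _ _ _ ⟨
      (_ + _) + _
        ≡⟨ cong₂ _+_ (unshuffle-+ _ _ L) refl ⟨
      unshuffle (λ u v → _ + _) L + _ ∎

    -- Both sides spread `L` over four piles, grouped by the letter on the left and by the index on
    -- the right. Exchanging the two middle piles is where cocommutativity enters the proof that
    -- dealing is a coalgebra morphism.
    unshuffle-interchange : ∀ (g : List A → List A → List A → List A → R) L →
      unshuffle (λ u v → unshuffle (λ u₁ u₂ → unshuffle (λ v₁ v₂ → g u₁ u₂ v₁ v₂) v) u) L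
      ≡ unshuffle (λ a b → unshuffle (λ u₁ v₁ → unshuffle (λ u₂ v₂ → g u₁ u₂ v₁ v₂) b) a) L
    unshuffle-interchange g []      = refl
    unshuffle-interchange g (x ∷ L) = begin
      unshuffle (λ u v → _ + _) L + unshuffle (λ u v → unshuffle (λ u₁ u₂ → _ + _) u) L
        ≡⟨ cong₂ _+_ (unshuffle-+ _ _ L)
             (trans (unshuffle-cong′ L (λ u v → unshuffle-+ _ _ u)) (unshuffle-+ _ _ L)) ⟩
      (_ + _) + (_ + _)
        ≡⟨ cong₂ _+_ (cong₂ _+_ (unshuffle-interchange _ L) (unshuffle-interchange _ L))
                     (cong₂ _+_ (unshuffle-interchange _ L) (unshuffle-interchange _ L)) ⟩
      (_ + _) + (_ + _)
        ≡⟨ interchange _ _ _ _ ⟩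
      (_ + _) + (_ + _)
        ≡⟨ cong₂ _+_ (unshuffle-+ _ _ L)
             (trans (unshuffle-cong′ L (λ u v → unshuffle-+ _ _ u)) (unshuffle-+ _ _ L)) ⟨
      unshuffle (λ a b → _ + _) L + unshuffle (λ a b → unshuffle (λ u₁ v₁ → _ + _) a) L ∎

    -- The coproduct is multiplicative for concatenation: the two parts are split independently.
    unshuffle-++ : ∀ ψ a b →
      unshuffle ψ (a ++ b) ≡ unshuffle (λ a₁ a₂ → unshuffle (λ b₁ b₂ → ψ (a₁ ++ b₁) (a₂ ++ b₂)) b) a
    unshuffle-++ ψ []      b = refl
    unshuffle-++ ψ (x ∷ a) b = cong₂ _+_ (unshuffle-++ _ a b) (unshuffle-++ _ a b)

    unshuffle-reverse : ∀ ψ L → unshuffle ψ (reverse L) ≡ unshuffle (λ u v → ψ (reverse u) (reverse v)) L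
    unshuffle-reverse ψ []      = refl
    unshuffle-reverse ψ (x ∷ L) = begin
      unshuffle ψ (reverse (x ∷ L))
        ≡⟨ cong (unshuffle ψ) (unfold-reverse x L) ⟩
      unshuffle ψ (reverse L ++ [ x ])
        ≡⟨ unshuffle-++ ψ (reverse L) [ x ] ⟩
      unshuffle (λ u v → ψ (u ++ [ x ]) (v ++ []) + ψ (u ++ []) (v ++ [ x ])) (reverse L)
        ≡⟨ unshuffle-+ _ _ (reverse L) ⟩
      unshuffle (λ u v → ψ (u ++ [ x ]) (v ++ [])) (reverse L) + unshuffle (λ u v → ψ (u ++ []) (v ++ [ x ])) (reverse L)
        ≡⟨ cong₂ _+_ (unshuffle-reverse _ L) (unshuffle-reverse _ L) ⟩
      unshuffle (λ u v → ψ (reverse u ++ [ x ]) (reverse v ++ [])) L + unshuffle (λ u v → ψ (reverse u ++ []) (reverse v ++ [ x ])) L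
        ≡⟨ cong₂ _+_
             (unshuffle-cong′ L (λ u v → cong₂ ψ (sym (unfold-reverse x u)) (++-identityʳ (reverse v))))
             (unshuffle-cong′ L (λ u v → cong₂ ψ (++-identityʳ (reverse u)) (sym (unfold-reverse x v)))) ⟩
      unshuffle (λ u v → ψ (reverse u) (reverse v)) (x ∷ L) ∎

    pile : Bool → List A → List A
    pile false u = u
    pile true  u = reverse u

    pile-[] : ∀ s → pile s [] ≡ []
    pile-[] false = refl
    pile-[] true  = refl

    pile-↭ : ∀ s u → pile s u ↭ u
    pile-↭ false u = ↭-refl
    pile-↭ true  u = ↭-reverse u

    unshuffle-pile : ∀ s ψ L → unshuffle ψ (pile s L) ≡ unshuffle (λ u v → ψ (pile s u) (pile s v)) L
    unshuffle-pile false ψ L = refl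
    unshuffle-pile true  ψ L = unshuffle-reverse ψ L

    reverse-pile : ∀ s u → reverse (pile s u) ≡ pile (not s) u
    reverse-pile false u = refl
    reverse-pile true  u = reverse-involutive u

    -- X(ε) acting on the deck L, with false for + and true for −.
    deal : List Bool → (List A → R) → List A → R
    deal []      φ []      = φ []
    deal []      φ (_ ∷ _) = 0#
    deal (s ∷ ε) φ L       = unshuffle (λ u v → deal ε (λ r → φ (pile s u ++ r)) v) L

    -- Restricted to rearrangements of `L` since the test functions compared later agree on
    -- permutations only.
    deal-cong : ∀ ε {φ φ′} L → (∀ r → r ↭ L → φ r ≡ φ′ r) → deal ε φ L ≡ deal ε φ′ L
    deal-cong []      []      h = h [] ↭-refl
    deal-cong []      (x ∷ L) h = refl
    deal-cong (s ∷ ε) L       h = unshuffle-cong L λ {u} {v} i → deal-cong ε v λ r r↭v →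
      h (pile s u ++ r) (↭-trans (++⁺ (pile-↭ s u) r↭v) (↭-sym (toPermutation i)))

    deal-cong′ : ∀ ε {φ φ′} L → (∀ r → φ r ≡ φ′ r) → deal ε φ L ≡ deal ε φ′ L
    deal-cong′ ε L h = deal-cong ε L (λ r _ → h r)

    deal-0 : ∀ ε L → deal ε (λ _ → 0#) L ≡ 0#
    deal-0 []      []      = refl
    deal-0 []      (x ∷ L) = refl
    deal-0 (s ∷ ε) L       = unshuffle-≡0 L (λ {u} {v} _ → deal-0 ε v)

    deal-≡0 : ∀ ε {φ} L → (∀ r → φ r ≡ 0#) → deal ε φ L ≡ 0#
    deal-≡0 ε L h = trans (deal-cong′ ε L h) (deal-0 ε L)

    deal-+ : ∀ ε L φ φ′ → deal ε (λ r → φ r + φ′ r) L ≡ deal ε φ L + deal ε φ′ L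
    deal-+ []      []      φ φ′ = refl
    deal-+ []      (x ∷ L) φ φ′ = sym (+-identityˡ 0#)
    deal-+ (s ∷ ε) L       φ φ′ =
      trans (unshuffle-cong′ L (λ u v → deal-+ ε v _ _)) (unshuffle-+ _ _ L)

    deal-*ʳ : ∀ ε L φ c → deal ε (λ r → φ r * c) L ≡ deal ε φ L * c
    deal-*ʳ []      []      φ c = refl
    deal-*ʳ []      (x ∷ L) φ c = sym (zeroˡ c)
    deal-*ʳ (s ∷ ε) L       φ c =
      trans (unshuffle-cong′ L (λ u v → deal-*ʳ ε v _ c)) (unshuffle-*ʳ _ c L)

    deal-swap : ∀ ε L (g : List A → List A → List A → R) L′ →
      unshuffle (λ u v → deal ε (g u v) L′) L ≡ deal ε (λ r → unshuffle (λ u v → g u v r) L) L′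
    deal-swap ε L g L′ = unshuffle-swap (λ f → deal ε f L′) (deal-+ ε L′) g L

    -- Counit law: an empty row of piles accepts no card, so only the split with `u` empty
    -- contributes.
    unshuffle-emptyˡ : ∀ (φ : List A → List A → R) L → unshuffle (λ u v → deal [] (λ r → φ r v) u) L ≡ φ [] L
    unshuffle-emptyˡ φ []      = refl
    unshuffle-emptyˡ φ (x ∷ L) =
      trans (cong₂ _+_ (unshuffle-0 L) (unshuffle-emptyˡ _ L)) (+-identityˡ _)

    deal-single : ∀ s φ L → deal [ s ] φ L ≡ φ (pile s L)
    deal-single s φ L = begin
      unshuffle (λ u v → deal [] (λ r → φ (pile s u ++ r)) v) L
        ≡⟨ unshuffle-comm _ L ⟩
      unshuffle (λ v u → deal [] (λ r → φ (pile s u ++ r)) v) L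
        ≡⟨ unshuffle-emptyˡ _ L ⟩
      φ (pile s L ++ [])
        ≡⟨ cong φ (++-identityʳ (pile s L)) ⟩
      φ (pile s L) ∎

    -- X(ε ε′) is the convolution product of X(ε) and X(ε′): the cards are first divided between the
    -- two rows of piles. Coassociativity lets the first pile be split off before or after this
    -- division.
    deal-++ : ∀ ε ε′ φ L →
      deal (ε ++ ε′) φ L ≡ unshuffle (λ u v → deal ε (λ r → deal ε′ (λ r′ → φ (r ++ r′)) v) u) L
    deal-++ []      ε′ φ L = sym (unshuffle-emptyˡ _ L)
    deal-++ (s ∷ ε) ε′ φ L = begin
      unshuffle (λ u v → deal (ε ++ ε′) (λ r → φ (pile s u ++ r)) v) L
        ≡⟨ unshuffle-cong′ L (λ u v → deal-++ ε ε′ _ v) ⟩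
      unshuffle (λ u v → unshuffle (λ v₁ v₂ → deal ε (λ r → deal ε′ (λ r′ → φ (pile s u ++ (r ++ r′))) v₂) v₁) v) L
        ≡⟨ unshuffle-assoc _ L ⟩
      unshuffle (λ u v → unshuffle (λ u₁ u₂ → deal ε (λ r → deal ε′ (λ r′ → φ (pile s u₁ ++ (r ++ r′))) v) u₂) u) L
        ≡⟨ unshuffle-cong′ L (λ u v → unshuffle-cong′ u (λ u₁ u₂ → deal-cong′ ε u₂ (λ r →
             deal-cong′ ε′ v (λ r′ → cong φ (sym (++-assoc (pile s u₁) r r′)))))) ⟩
      unshuffle (λ u v → unshuffle (λ u₁ u₂ → deal ε (λ r → deal ε′ (λ r′ → φ ((pile s u₁ ++ r) ++ r′)) v) u₂) u) L ∎

    -- Dealing is a coalgebra morphism for the unshuffle coproduct.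
    deal-unshuffle : ∀ ε ψ L →
      deal ε (unshuffle ψ) L ≡ unshuffle (λ a b → deal ε (λ r → deal ε (λ r′ → ψ r r′) b) a) L
    deal-unshuffle []      ψ []      = refl
    deal-unshuffle []      ψ (x ∷ L) = sym (begin
      unshuffle (λ a b → 0#) L + unshuffle (λ a b → deal [] (λ r → 0#) a) L
        ≡⟨ cong₂ _+_ (unshuffle-0 L) (unshuffle-≡0 L (λ {a} {b} _ → deal-0 [] a)) ⟩
      0# + 0#
        ≡⟨ +-identityˡ 0# ⟩
      0# ∎)
    deal-unshuffle (s ∷ ε) ψ L = begin
      unshuffle (λ u v → deal ε (λ r → unshuffle ψ (pile s u ++ r)) v) L
        ≡⟨ unshuffle-cong′ L (λ u v → deal-cong′ ε v (λ r →
             trans (unshuffle-++ ψ (pile s u) r) (unshuffle-pile s _ u))) ⟩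
      unshuffle (λ u v → deal ε (λ r → unshuffle (λ u₁ u₂ →
        unshuffle (λ r₁ r₂ → ψ (pile s u₁ ++ r₁) (pile s u₂ ++ r₂)) r) u) v) L
        ≡⟨ unshuffle-cong′ L (λ u v → deal-swap ε u _ v) ⟨
      unshuffle (λ u v → unshuffle (λ u₁ u₂ → deal ε (unshuffle (λ r₁ r₂ →
        ψ (pile s u₁ ++ r₁) (pile s u₂ ++ r₂))) v) u) L
        ≡⟨ unshuffle-cong′ L (λ u v → unshuffle-cong′ u (λ u₁ u₂ → deal-unshuffle ε _ v)) ⟩
      unshuffle (λ u v → unshuffle (λ u₁ u₂ → unshuffle (λ v₁ v₂ → deal ε (λ r₁ → deal ε (λ r₂ →
        ψ (pile s u₁ ++ r₁) (pile s u₂ ++ r₂)) v₂) v₁) v) u) L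
        ≡⟨ unshuffle-interchange _ L ⟩
      unshuffle (λ a b → unshuffle (λ u₁ v₁ → unshuffle (λ u₂ v₂ → deal ε (λ r₁ → deal ε (λ r₂ →
        ψ (pile s u₁ ++ r₁) (pile s u₂ ++ r₂)) v₂) v₁) b) a) L
        ≡⟨ unshuffle-cong′ L (λ a b → unshuffle-cong′ a (λ u₁ v₁ → deal-swap ε b _ v₁)) ⟩
      unshuffle (λ a b → unshuffle (λ u₁ v₁ → deal ε (λ r₁ → unshuffle (λ u₂ v₂ → deal ε (λ r₂ →
        ψ (pile s u₁ ++ r₁) (pile s u₂ ++ r₂)) v₂) b) v₁) a) L ∎

    -- Reversing the finished stack reverses the order of the piles and turns each of them over.
    deal-flipReverse : ∀ ε φ L → deal (flipReverse ε) φ L ≡ deal ε (λ r → φ (reverse r)) L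
    deal-flipReverse []      φ []      = refl
    deal-flipReverse []      φ (x ∷ L) = refl
    deal-flipReverse (s ∷ ε) φ L       = begin
      deal (flipReverse ε ++ [ not s ]) φ L
        ≡⟨ deal-++ (flipReverse ε) [ not s ] φ L ⟩
      unshuffle (λ u v → deal (flipReverse ε) (λ r → deal [ not s ] (λ r′ → φ (r ++ r′)) v) u) L
        ≡⟨ unshuffle-cong′ L (λ u v → trans (deal-flipReverse ε _ u)
             (deal-cong′ ε u (λ r → deal-single (not s) (λ r′ → φ (reverse r ++ r′)) v))) ⟩
      -- The pile dealt last on this side is the first one of `s ∷ ε`; cocommutativity exchanges the
      -- two parts.
      unshuffle (λ u v → deal ε (λ r → φ (reverse r ++ pile (not s) v)) u) L
        ≡⟨ unshuffle-comm _ L ⟩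
      unshuffle (λ v u → deal ε (λ r → φ (reverse r ++ pile (not s) v)) u) L
        ≡⟨ unshuffle-cong′ L (λ v u → deal-cong′ ε u (λ r → cong φ (trans
             (cong (reverse r ++_) (sym (reverse-pile s v))) (sym (reverse-++ (pile s v) r))))) ⟩
      unshuffle (λ v u → deal ε (λ r → φ (reverse (pile s v ++ r))) u) L ∎

    deal-block : ∀ ε s φ L → deal (block ε s) φ L ≡ deal ε (λ r → φ (pile s r)) L
    deal-block ε false φ L = refl
    deal-block ε true  φ L = deal-flipReverse ε φ L

    deal-[]-++ : ∀ φ a r → deal [] φ (a ++ r) ≡ deal [] (λ l → deal [] (λ r′ → φ (l ++ r′)) r) a
    deal-[]-++ φ []      r = refl
    deal-[]-++ φ (x ∷ a) r = refl

    deal-[]-pile : ∀ s φ u → deal [] φ (pile s u) ≡ deal [] φ u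
    deal-[]-pile false φ u       = refl
    deal-[]-pile true  φ []      = refl
    deal-[]-pile true  φ (x ∷ u) = trans (cong (deal [] φ) (unfold-reverse x u)) (nonempty (reverse u))
      where
      nonempty : ∀ l → deal [] φ (l ++ [ x ]) ≡ 0#
      nonempty []      = refl
      nonempty (y ∷ l) = refl

    -- `deal [] φ` is `φ []` times the counit, and dealing preserves the counit since no card gets
    -- lost.
    deal-null : ∀ ε φ L → deal ε (deal [] φ) L ≡ deal [] φ L
    deal-null []      φ []      = refl
    deal-null []      φ (x ∷ L) = refl
    deal-null (s ∷ ε) φ L       = begin
      unshuffle (λ u v → deal ε (λ r → deal [] φ (pile s u ++ r)) v) L
        ≡⟨ unshuffle-cong′ L split ⟩
      unshuffle (λ u v → deal [] (λ l → deal [] (λ r → φ (l ++ r)) v) u) L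
        ≡⟨ unshuffle-emptyˡ _ L ⟩
      deal [] φ L ∎
      where
      split : ∀ u v → deal ε (λ r → deal [] φ (pile s u ++ r)) v
                      ≡ deal [] (λ l → deal [] (λ r → φ (l ++ r)) v) u
      split []      v = trans (deal-cong′ ε v (λ r → cong (λ l → deal [] φ (l ++ r)) (pile-[] s))) (deal-null ε φ v)
      split (x ∷ u) v = deal-≡0 ε v (λ r → trans (deal-[]-++ φ (pile s (x ∷ u)) r) (deal-[]-pile s _ (x ∷ u)))

    -- Splitting off the first pile of the second deal after the first deal is the same as splitting
    -- the deck and dealing both parts by `ε`, since dealing is a coalgebra morphism. Hence the
    -- letter `s` of `δ` contributes a copy of `ε`, turned over if `s` is -.
    deal-deal : ∀ ε δ φ L → deal ε (deal δ φ) L ≡ deal (concatMap (block ε) δ) φ L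
    deal-deal ε []      φ L = deal-null ε φ L
    deal-deal ε (s ∷ δ) φ L = begin
      deal ε (unshuffle (λ u v → deal δ (λ t → φ (pile s u ++ t)) v)) L
        ≡⟨ deal-unshuffle ε _ L ⟩
      unshuffle (λ a b → deal ε (λ r → deal ε (λ r′ → deal δ (λ t → φ (pile s r ++ t)) r′) b) a) L
        ≡⟨ unshuffle-cong′ L (λ a b → deal-cong′ ε a (λ r → deal-deal ε δ _ b)) ⟩
      unshuffle (λ a b → deal ε (λ r → deal (concatMap (block ε) δ) (λ t → φ (pile s r ++ t)) b) a) L
        ≡⟨ unshuffle-cong′ L (λ a b → deal-block ε s _ a) ⟨
      unshuffle (λ a b → deal (block ε s) (λ r → deal (concatMap (block ε) δ) (λ t → φ (r ++ t)) b) a) L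
        ≡⟨ deal-++ (block ε s) _ φ L ⟨
      deal (block ε s ++ concatMap (block ε) δ) φ L ∎

  unshuffle-map : ∀ {A B : Set} (f : A → B) ψ L →
                  unshuffle ψ (map f L) ≡ unshuffle (λ u v → ψ (map f u) (map f v)) L
  unshuffle-map f ψ []      = refl
  unshuffle-map f ψ (x ∷ L) = cong₂ _+_ (unshuffle-map f _ L) (unshuffle-map f _ L)

  map-pile : ∀ {A B : Set} (f : A → B) s u → map f (pile s u) ≡ pile s (map f u)
  map-pile f false u = refl
  map-pile f true  u = reverse-map f u

  deal-map : ∀ {A B : Set} (f : A → B) ε φ L → deal ε φ (map f L) ≡ deal ε (λ r → φ (map f r)) L
  deal-map f []      φ []      = refl
  deal-map f []      φ (x ∷ L) = refl
  deal-map f (s ∷ ε) φ L       = begin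
    unshuffle (λ u v → deal ε (λ r → φ (pile s u ++ r)) v) (map f L)
      ≡⟨ unshuffle-map f _ L ⟩
    unshuffle (λ u v → deal ε (λ r → φ (pile s (map f u) ++ r)) (map f v)) L
      ≡⟨ unshuffle-cong′ L (λ u v → trans (deal-map f ε _ v) (deal-cong′ ε v (λ r → cong φ
           (sym (trans (map-++ f (pile s u) r) (cong (_++ map f r) (map-pile f s u))))))) ⟩
    unshuffle (λ u v → deal ε (λ r → φ (map f (pile s u ++ r))) v) L ∎

  -- Coefficients as numbers of cuts

  module _ {A : Set} where
    cutSum : (List A → List A → R) → List A → R
    cutSum ψ []      = ψ [] []
    cutSum ψ (x ∷ w) = ψ [] (x ∷ w) + cutSum (λ a b → ψ (x ∷ a) b) w

    cutSum-cong : ∀ {ψ ψ′} w → (∀ a b → a ++ b ≡ w → ψ a b ≡ ψ′ a b) → cutSum ψ w ≡ cutSum ψ′ w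
    cutSum-cong []      h = h [] [] refl
    cutSum-cong (x ∷ w) h =
      cong₂ _+_ (h [] (x ∷ w) refl) (cutSum-cong w (λ a b e → h (x ∷ a) b (cong (x ∷_) e)))

    cutSum-0 : ∀ w → cutSum (λ _ _ → 0#) w ≡ 0#
    cutSum-0 []      = refl
    cutSum-0 (x ∷ w) = trans (cong (0# +_) (cutSum-0 w)) (+-identityˡ 0#)

    cutSum-≡0 : ∀ {ψ} w → (∀ a b → ψ a b ≡ 0#) → cutSum ψ w ≡ 0#
    cutSum-≡0 w h = trans (cutSum-cong w (λ a b _ → h a b)) (cutSum-0 w)

    cutSum-swap : ∀ {B : Set} (Λ : (B → R) → R) →
                  (∀ f g → Λ (λ c → f c + g c) ≡ Λ f + Λ g) →
                  ∀ (g : List A → List A → B → R) w →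
                  cutSum (λ a b → Λ (g a b)) w ≡ Λ (λ c → cutSum (λ a b → g a b c) w)
    cutSum-swap Λ Λ-+ g []      = refl
    cutSum-swap Λ Λ-+ g (x ∷ w) =
      trans (cong (Λ (g [] (x ∷ w)) +_) (cutSum-swap Λ Λ-+ _ w)) (sym (Λ-+ _ _))

  bit : Bool → R
  bit b = if b then 1# else 0#

  ind : List ℕ → List ℕ → R
  ind u w = bit (eqList u w)

  ind-refl : ∀ w → ind w w ≡ 1#
  ind-refl w = cong bit (eqList-refl w)

  ind-≢ : ∀ {u w} → u ≢ w → ind u w ≡ 0#
  ind-≢ {u} {w} u≢w with eqList u w in e
  ... | true  = contradiction (eqList-sound u w e) u≢w
  ... | false = refl

  -- At most one cut of `w` has `c` as its first factor, so the sum over all cuts has at most one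
  -- nonzero term.
  ind-++ : ∀ c r w → ind (c ++ r) w ≡ cutSum (λ a b → ind c a * ind r b) w
  ind-++ []      r []      = sym (*-identityˡ _)
  ind-++ []      r (y ∷ w) = sym (trans (cong₂ _+_ (*-identityˡ _) (cutSum-≡0 w (λ a b → zeroˡ _))) (+-identityʳ _))
  ind-++ (x ∷ c) r []      = sym (zeroˡ _)
  ind-++ (x ∷ c) r (y ∷ w) with x ≡ᵇ y
  ... | true  = sym (trans (cong₂ _+_ (zeroˡ _) (sym (ind-++ c r w))) (+-identityˡ _))
  ... | false = sym (trans (cong₂ _+_ (zeroˡ _) (cutSum-≡0 w (λ a b → zeroˡ _))) (+-identityˡ _))

  -- The set of cards in `a` determines the split, so exactly one split of the sorted deck has `a`
  -- on the left. Its other half is `b` in sorted order, which is all that `ψ` is asked about.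
  -- Induction on the least card, which heads `a` or lies in `b`.
  unshuffle-sorted : ∀ {L a b} (ψ : List ℕ → R) c → AllPairs _<_ L → AllPairs _<_ a → a ++ b ↭ L →
                     (∀ v → AllPairs _<_ v → b ↭ v → ψ v ≡ c) →
                     unshuffle (λ u v → ind u a * ψ v) L ≡ c
  unshuffle-sorted {[]}    {[]}    ψ c _ _ p h = trans (*-identityˡ _) (h [] [] p)
  unshuffle-sorted {[]}    {_ ∷ _} ψ c _ _ p h = contradiction p ¬x∷xs↭[]
  unshuffle-sorted {x ∷ L} {a} {b} ψ c (x<L ∷ L<) a< p h = cases a a< p
    where
    skip : ∀ a → AllPairs _<_ a → a ++ b ↭ x ∷ L → x ∉ a →
           unshuffle (λ u v → ind u a * ψ v) (x ∷ L) ≡ c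
    skip a a< p x∉a with ∈-++⁻ a (∈-resp-↭ (↭-sym p) (here refl))
    ... | inj₁ x∈a = contradiction x∈a x∉a
    ... | inj₂ x∈b with ∈-∃++ x∈b
    ... | b₁ , b₂ , refl = trans (cong₂ _+_
      (unshuffle-≡0 L (λ {u} _ →
        trans (cong (_* _) (ind-≢ {x ∷ u} {a} (λ { refl → x∉a (here refl) }))) (zeroˡ _)))
      (unshuffle-sorted (λ v → ψ (x ∷ v)) c L< a< p′ (λ v v< q →
        h (x ∷ v) (All-resp-↭ q (All.++⁻ʳ a (All-resp-↭ (↭-sym p′) x<L)) ∷ v<)
          (↭-trans (shift x b₁ b₂) (prep x q)))))
      (+-identityˡ c)
      where
      p′ : a ++ (b₁ ++ b₂) ↭ L
      p′ = drop-∷ (↭-trans (↭-sym (shift x a (b₁ ++ b₂))) (↭-trans (++⁺ˡ a (↭-sym (shift x b₁ b₂))) p))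
    cases : ∀ a → AllPairs _<_ a → a ++ b ↭ x ∷ L → unshuffle (λ u v → ind u a * ψ v) (x ∷ L) ≡ c
    cases []      a< p = skip [] a< p (λ ())
    cases (y ∷ a) (y<a ∷ a<) p with x ≟ y
    ... | yes refl = trans (cong₂ _+_
      (trans (unshuffle-cong′ L (λ u v → cong (λ t → bit (t ∧ eqList u a) * ψ v) (≡ᵇ-refl x)))
             (unshuffle-sorted ψ c L< a< (drop-∷ p) h))
      (unshuffle-≡0 L (λ {u} i → trans (cong (_* _) (ind-≢ (x∉ i))) (zeroˡ _))))
      (+-identityʳ c)
      where
      x∉ : ∀ {u v} → Interleaving u v L → u ≢ x ∷ a
      x∉ i refl = ℕ.<-irrefl refl (All.head (Interleaving-All i x<L))
    -- The least card `x` of the deck cannot occur in `a` behind a different head `y`: then `y < x`,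
    -- but `y` is in the deck as well.
    ... | no x≢y = skip (y ∷ a) (y<a ∷ a<) p λ
      { (here x≡y)  → x≢y x≡y
      ; (there x∈a) → y≮x (All.lookup y<a x∈a) }
      where
      y≮x : ¬ y < x
      y≮x y<x with ∈-resp-↭ p (here refl)
      ... | here y≡x  = x≢y (sym y≡x)
      ... | there y∈L = ℕ.<-asym y<x (All.lookup x<L y∈L)

  unshuffle-unsorted : ∀ {L a} (ψ : List ℕ → R) → AllPairs _<_ L → ¬ AllPairs _<_ a →
                       unshuffle (λ u v → ind u a * ψ v) L ≡ 0#
  unshuffle-unsorted {L} {a} ψ L< a≮ = unshuffle-≡0 L λ {u} i →
    trans (cong (_* _) (ind-≢ {u} {a} (λ { refl → a≮ (Interleaving-AllPairs i L<) }))) (zeroˡ _)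

  ind-pile : ∀ s u a → ind (pile s u) a ≡ ind u (pile s a)
  ind-pile false u a = refl
  ind-pile true  u a with eqList (reverse u) a in e | eqList u (reverse a) in e′
  ... | true  | true  = refl
  ... | false | false = refl
  ... | true  | false = contradiction
    (trans (sym (eqList-refl u)) (trans (cong (eqList u)
      (trans (sym (reverse-involutive u)) (cong reverse (eqList-sound (reverse u) a e)))) e′)) λ ()
  ... | false | true  = contradiction
    (trans (sym (eqList-refl a)) (trans (cong (λ l → eqList l a)
      (trans (sym (reverse-involutive a)) (cong reverse (sym (eqList-sound u (reverse a) e′))))) e)) λ ()

  Linked⇒sorted : ∀ s {a} → Linked (Step s) a → AllPairs _<_ (pile s a)
  Linked⇒sorted false p = Linked⇒AllPairs ℕ.<-trans p
  Linked⇒sorted true  p = AllPairs-reverse (Linked⇒AllPairs (Step-trans true) p)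

  sorted⇒Linked : ∀ s {a} → AllPairs _<_ (pile s a) → Linked (Step s) a
  sorted⇒Linked false p = AllPairs⇒Linked p
  sorted⇒Linked true {a} p =
    AllPairs⇒Linked (subst (AllPairs _>_) (reverse-involutive a) (AllPairs-reverse p))

  cuts : List Bool → List ℕ → R
  cuts []      []      = 1#
  cuts []      (_ ∷ _) = 0#
  cuts (s ∷ ε) w       = cutSum (λ a b → bit (monotone s a) * cuts ε b) w

  -- A pile from a sorted deck is increasing, or decreasing once turned over. Conversely, each cut
  -- of `w` into factors of the prescribed directions comes from one deal, in which every factor
  -- names the cards of its pile.
  deal-ind : ∀ ε {L w} → AllPairs _<_ L → Unique w → w ↭ L → deal ε (λ r → ind r w) L ≡ cuts ε w
  deal-ind [] {[]}    {[]}    L< w! p = refl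
  deal-ind [] {[]}    {x ∷ w} L< w! p = contradiction p ¬x∷xs↭[]
  deal-ind [] {x ∷ L} {[]}    L< w! p = contradiction (↭-sym p) ¬x∷xs↭[]
  deal-ind [] {x ∷ L} {y ∷ w} L< w! p = refl
  deal-ind (s ∷ ε) {L} {w} L< w! p = begin
    unshuffle (λ u v → deal ε (λ r → ind (pile s u ++ r) w) v) L
      ≡⟨ unshuffle-cong′ L (λ u v → begin
           deal ε (λ r → ind (pile s u ++ r) w) v
             ≡⟨ deal-cong′ ε v (λ r → ind-++ (pile s u) r w) ⟩
           deal ε (λ r → cutSum (λ a b → ind (pile s u) a * ind r b) w) v
             ≡⟨ cutSum-swap (λ f → deal ε f v) (deal-+ ε v) _ w ⟨
           cutSum (λ a b → deal ε (λ r → ind (pile s u) a * ind r b) v) w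
             ≡⟨ cutSum-cong w (λ a b _ → deal-*ˡ v (ind (pile s u) a) b) ⟩
           cutSum (λ a b → ind (pile s u) a * deal ε (λ r → ind r b) v) w ∎) ⟩
    unshuffle (λ u v → cutSum (λ a b → ind (pile s u) a * deal ε (λ r → ind r b) v) w) L
      -- With the sum over cuts outermost, each cut `(a , b)` can be treated separately: the split
      -- of the deck is then forced.
      ≡⟨ cutSum-swap (λ f → unshuffle (λ u v → f (u , v)) L) (λ f g → unshuffle-+ _ _ L) _ w ⟨
    cutSum (λ a b → unshuffle (λ u v → ind (pile s u) a * deal ε (λ r → ind r b) v) L) w
      ≡⟨ cutSum-cong w (λ a b e → trans
           (unshuffle-cong′ L (λ u v → cong (_* _) (ind-pile s u a)))
           (factor a b e)) ⟩
    cutSum (λ a b → bit (monotone s a) * cuts ε b) w ∎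
    where
    deal-*ˡ : ∀ v c b → deal ε (λ r → c * ind r b) v ≡ c * deal ε (λ r → ind r b) v
    deal-*ˡ v c b = trans (deal-cong′ ε v (λ r → *-comm c _)) (trans (deal-*ʳ ε v _ c) (*-comm _ c))
    factor : ∀ a b → a ++ b ≡ w →
      unshuffle (λ u v → ind u (pile s a) * deal ε (λ r → ind r b) v) L ≡ bit (monotone s a) * cuts ε b
    factor a b refl with AllPairs-++⁻ a w!
      where
      AllPairs-++⁻ : ∀ a {b} → Unique (a ++ b) → Unique a × Unique b
      AllPairs-++⁻ []      b! = [] , b!
      AllPairs-++⁻ (x ∷ a) (x∉ ∷ ab!) = All.++⁻ˡ a x∉ ∷ proj₁ (AllPairs-++⁻ a ab!) , proj₂ (AllPairs-++⁻ a ab!)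
    ... | a! , b! with monotone? s a a!
    ... | inj₁ (e , m) rewrite e = trans
      (unshuffle-sorted _ (cuts ε b) L< (Linked⇒sorted s m) (↭-trans (++⁺ʳ b (pile-↭ s a)) p)
        (λ v v< q → deal-ind ε v< b! q))
      (sym (*-identityˡ _))
    ... | inj₂ (e , m) rewrite e =
      trans (unshuffle-unsorted _ L< (λ q → m (sorted⇒Linked s q))) (sym (zeroˡ _))

  -- Recursion for the numbers of cuts

  cuts-[] : ∀ ε → cuts ε [] ≡ 1#
  cuts-[] []      = refl
  cuts-[] (s ∷ ε) = trans (*-identityˡ _) (cuts-[] ε)

  cuts-singleton : ∀ s ε x → cuts (s ∷ ε) (x ∷ []) ≡ cuts ε (x ∷ []) + 1#
  cuts-singleton s ε x = cong₂ _+_ (*-identityˡ _) (trans (*-identityˡ _) (cuts-[] ε))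

  -- Either the first factor is empty or it contains `x`. In the second case a step against `s` ends
  -- it after `x`; otherwise `x` may be deleted from it, a factor consisting of `x` alone becoming
  -- empty.
  cuts-step : ∀ s ε x y w → cuts (s ∷ ε) (x ∷ y ∷ w) ≡
    cuts ε (x ∷ y ∷ w) + (if (y <ᵇ x) xor s then cuts ε (y ∷ w) else cuts (s ∷ ε) (y ∷ w))
  cuts-step s ε x y w = cong₂ _+_ (*-identityˡ _) first
    where
    first : (bit true * cuts ε (y ∷ w)) +
            cutSum (λ a b → bit (if (y <ᵇ x) xor s then false else monotone s (y ∷ a)) * cuts ε b) w
            ≡ (if (y <ᵇ x) xor s then cuts ε (y ∷ w) else cuts (s ∷ ε) (y ∷ w))
    first with (y <ᵇ x) xor s
    ... | true  = trans (cong₂ _+_ (*-identityˡ _) (cutSum-≡0 w (λ a b → zeroˡ _))) (+-identityʳ _)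
    ... | false = refl

  -- The recursion of `cuts-step` in terms of the steps alone. The list `ds` belongs to a word with
  -- one letter more, hence nonempty, so there is no cut into zero factors.
  altCuts : ℕ → Bool → List Bool → R
  altCuts zero    s ds       = 0#
  altCuts (suc m) s []       = altCuts m (not s) [] + 1#
  altCuts (suc m) s (d ∷ ds) =
    altCuts m (not s) (d ∷ ds) + (if d xor s then altCuts m (not s) ds else altCuts (suc m) s ds)

  cuts-alternating : ∀ m s x w → cuts (alternating m s) (x ∷ w) ≡ altCuts m s (descents (x ∷ w))
  cuts-alternating zero    s x w       = refl
  cuts-alternating (suc m) s x []      =
    trans (cuts-singleton s (alternating m (not s)) x) (cong (_+ 1#) (cuts-alternating m (not s) x []))
  cuts-alternating (suc m) s x (y ∷ w) = trans (cuts-step s (alternating m (not s)) x y w)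
    (cong₂ _+_ (cuts-alternating m (not s) x (y ∷ w))
      (cong₂ (if (y <ᵇ x) xor s then_else_) (cuts-alternating m (not s) y w) (cuts-alternating (suc m) s y w)))

  -- For `f 0 = 0` these multiply the generating function of `f` by (1 + t²)/(1 - t²) and by 2t/(1 -
  -- t²).
  straight turning : (ℕ → R) → ℕ → R
  straight f 0             = 0#
  straight f 1             = f 1
  straight f (suc (suc m)) = (straight f m + f m) + f (suc (suc m))
  turning f 0             = 0#
  turning f 1             = 0#
  turning f (suc (suc m)) = (turning f m + f (suc m)) + f (suc m)

  -- Two rounds of the recursion lead from the sign `s` to its opposite and back, which eliminates
  -- the sequence of the other sign and leaves a recursion from `m` to `m + 2`. Likewise for
  -- `altCuts-turning`.
  altCuts-straight : ∀ s ds m → altCuts m s (s ∷ ds) ≡ straight (λ m → altCuts m s ds) m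
  altCuts-straight s     ds 0             = refl
  altCuts-straight false ds 1             = +-identityˡ _
  altCuts-straight true  ds 1             = +-identityˡ _
  altCuts-straight false ds (suc (suc m)) = +-congʳ (+-congʳ (altCuts-straight false ds m))
  altCuts-straight true  ds (suc (suc m)) = +-congʳ (+-congʳ (altCuts-straight true ds m))

  altCuts-turning : ∀ s ds m → altCuts m (not s) (s ∷ ds) ≡ turning (λ m → altCuts m s ds) m
  altCuts-turning s     ds 0             = refl
  altCuts-turning false ds 1             = +-identityˡ _
  altCuts-turning true  ds 1             = +-identityˡ _
  altCuts-turning false ds (suc (suc m)) = +-congʳ (+-congʳ (altCuts-turning false ds m))
  altCuts-turning true  ds (suc (suc m)) = +-congʳ (+-congʳ (altCuts-turning true ds m))

  straight-cong : ∀ {f g} → (∀ m → f m ≡ g m) → ∀ m → straight f m ≡ straight g m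
  straight-cong h 0             = refl
  straight-cong h 1             = h 1
  straight-cong h (suc (suc m)) = cong₂ _+_ (cong₂ _+_ (straight-cong h m) (h m)) (h (suc (suc m)))

  turning-cong : ∀ {f g} → (∀ m → f m ≡ g m) → ∀ m → turning f m ≡ turning g m
  turning-cong h 0             = refl
  turning-cong h 1             = refl
  turning-cong h (suc (suc m)) = cong₂ _+_ (cong₂ _+_ (turning-cong h m) (h (suc m))) (h (suc m))

  straight-suc : ∀ {f} → f 0 ≡ 0# → ∀ m → straight f (suc m) ≡ turning f m + f (suc m)
  straight-suc f0 0             = sym (+-identityˡ _)
  straight-suc {f} f0 1         = cong (_+ f 2) (trans (+-identityˡ _) f0)
  straight-suc f0 (suc (suc m)) = +-congʳ (+-congʳ (straight-suc f0 m))

  -- Multiplications by power series commute. `straight-suc` is the relation (1 + t²)/(1 - t²) = t ·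
  -- 2t/(1 - t²) + 1 between the two series.
  straight-turning : ∀ {f} → f 0 ≡ 0# → ∀ m → straight (turning f) m ≡ turning (straight f) m
  straight-turning f0 0 = refl
  straight-turning f0 1 = refl
  straight-turning {f} f0 (suc (suc m)) = begin
    (straight (turning f) m + u) + ((u + v) + v)
      ≡⟨ +-congʳ (+-congʳ (straight-turning f0 m)) ⟩
    (turning (straight f) m + u) + ((u + v) + v)
      ≡⟨ +-congˡ (+-comm _ v) ⟩
    (turning (straight f) m + u) + (v + (u + v))
      ≡⟨ +-assoc _ v _ ⟨
    ((turning (straight f) m + u) + v) + (u + v)
      ≡⟨ +-congʳ (+-assoc _ u v) ⟩
    (turning (straight f) m + (u + v)) + (u + v)
      ≡⟨ cong (λ t → (turning (straight f) m + t) + t) (straight-suc f0 m) ⟨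
    (turning (straight f) m + straight f (suc m)) + straight f (suc m) ∎
    where
    u v : R
    u = turning f m
    v = f (suc m)

  -- A single letter goes into any one of the `m` factors; the generating function is t/(1 - t)².
  embed : ℕ → R
  embed zero    = 0#
  embed (suc m) = embed m + 1#

  altCuts-[] : ∀ m s → altCuts m s [] ≡ embed m
  altCuts-[] zero    s = refl
  altCuts-[] (suc m) s = cong (_+ 1#) (altCuts-[] m (not s))

  -- runCuts i j m is the coefficient, in the sum of all ways to deal onto m alternating piles, of a
  -- permutation of i + j + 1 letters with j turns, counting the one at the start against the first pile.
  runCuts : ℕ → ℕ → ℕ → R
  runCuts zero    zero    = embed
  runCuts (suc i) zero    = straight (runCuts i zero)
  runCuts i       (suc j) = turning (runCuts i j)

  runCuts-0 : ∀ i j → runCuts i j 0 ≡ 0#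
  runCuts-0 zero    zero    = refl
  runCuts-0 (suc i) zero    = refl
  runCuts-0 zero    (suc j) = refl
  runCuts-0 (suc i) (suc j) = refl

  runCuts-turning : ∀ i j m → runCuts i (suc j) m ≡ turning (runCuts i j) m
  runCuts-turning zero    j m = refl
  runCuts-turning (suc i) j m = refl

  runCuts-straight : ∀ i j m → straight (runCuts i j) m ≡ runCuts (suc i) j m
  runCuts-straight i zero    m = refl
  runCuts-straight i (suc j) m = begin
    straight (runCuts i (suc j)) m
      ≡⟨ straight-cong (runCuts-turning i j) m ⟩
    straight (turning (runCuts i j)) m
      ≡⟨ straight-turning (runCuts-0 i j) m ⟩
    turning (straight (runCuts i j)) m
      ≡⟨ turning-cong (runCuts-straight i j) m ⟩
    turning (runCuts (suc i) j) m ∎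

  -- Each step applies `straight` or `turning`. As these commute, only the number of times each is
  -- applied matters, not the order.
  altCuts-turns : ∀ ds s → ∃ λ i → i ℕ.+ turns s ds ≡ length ds ×
                                   (∀ m → altCuts m s ds ≡ runCuts i (turns s ds) m)
  altCuts-turns []           s = 0 , refl , λ m → altCuts-[] m s
  altCuts-turns (d ∷ ds) s with altCuts-turns ds d
  altCuts-turns (false ∷ ds) false | i , e , h = suc i , cong suc e , λ m →
    trans (altCuts-straight false ds m) (trans (straight-cong h m) (runCuts-straight i _ m))
  altCuts-turns (true ∷ ds)  true  | i , e , h = suc i , cong suc e , λ m →
    trans (altCuts-straight true ds m) (trans (straight-cong h m) (runCuts-straight i _ m))
  altCuts-turns (false ∷ ds) true  | i , e , h = i , trans (ℕ.+-suc i _) (cong suc e) , λ m →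
    trans (altCuts-turning false ds m) (trans (turning-cong h m) (sym (runCuts-turning i _ m)))
  altCuts-turns (true ∷ ds)  false | i , e , h = i , trans (ℕ.+-suc i _) (cong suc e) , λ m →
    trans (altCuts-turning true ds m) (trans (turning-cong h m) (sym (runCuts-turning i _ m)))

  -- `straight` multiplies by an even series and so respects the parity of the index; `turning`,
  -- below, multiplies by an odd one and swaps the parities.
  straight-even : ∀ {f g} → (∀ m → odd m ≡ false → f m ≡ g m) →
                  ∀ m → odd m ≡ false → straight f m ≡ straight g m
  straight-even h 0             e = refl
  straight-even h (suc (suc m)) e =
    cong₂ _+_ (cong₂ _+_ (straight-even h m (odd-2+ m e)) (h m (odd-2+ m e))) (h (suc (suc m)) e)

  turning-parity : ∀ {f g b} → (∀ m → odd m ≡ b → f m ≡ g m) →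
                   ∀ m → odd m ≡ not b → turning f m ≡ turning g m
  turning-parity h 0             e = refl
  turning-parity h 1             e = refl
  turning-parity h (suc (suc m)) e =
    cong₂ _+_ (cong₂ _+_ (turning-parity h m (odd-2+ m e)) f≡g) f≡g
    where f≡g = h (suc m) (not-injective e)

  -- The two multipliers differ by (1 - t)/(1 + t), and its product with t/(1 - t)² is t/(1 - t²),
  -- an odd series. The further factors for `i` are even.
  straight≡turning : ∀ i m → odd m ≡ false → straight (runCuts i 0) m ≡ turning (runCuts i 0) m
  straight≡turning zero 0 e = refl
  straight≡turning zero (suc (suc m)) e = begin
    (straight embed m + embed m) + ((embed m + 1#) + 1#)
      ≡⟨ +-congʳ (+-congʳ (straight≡turning zero m (odd-2+ m e))) ⟩
    (turning embed m + embed m) + ((embed m + 1#) + 1#)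
      ≡⟨ +-congˡ (+-comm _ 1#) ⟩
    (turning embed m + embed m) + (1# + (embed m + 1#))
      ≡⟨ +-assoc _ 1# _ ⟨
    ((turning embed m + embed m) + 1#) + (embed m + 1#)
      ≡⟨ +-congʳ (+-assoc _ _ 1#) ⟩
    (turning embed m + (embed m + 1#)) + (embed m + 1#) ∎
  straight≡turning (suc i) m e =
    trans (straight-even (straight≡turning i) m e) (straight-turning (runCuts-0 i 0) m)

  -- Behind the peak algebras, and behind C, the centraliser in W± of the longest element.
  runCuts-parity : ∀ i j m → odd m ≡ odd j → runCuts (suc i) j m ≡ runCuts i (suc j) m
  runCuts-parity i zero    m e = trans (straight≡turning i m e) (sym (runCuts-turning i 0 m))
  runCuts-parity i (suc j) m e =
    trans (turning-parity (runCuts-parity i j) m e) (sym (runCuts-turning i (suc j) m))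

  pow2 : ℕ → R
  pow2 zero    = 1#
  pow2 (suc j) = pow2 j + pow2 j

  turning-vanish : ∀ {f j} → (∀ m → m ≤ j → f m ≡ 0#) → ∀ m → m ≤ suc j → turning f m ≡ 0#
  turning-vanish h 0             le = refl
  turning-vanish h 1             le = refl
  turning-vanish h (suc (suc m)) (s≤s le) = trans
    (cong₂ _+_ (cong₂ _+_ (turning-vanish h m (ℕ.m≤n⇒m≤1+n (ℕ.<⇒≤ le))) (h (suc m) le)) (h (suc m) le))
    (trans (+-identityʳ _) (+-identityʳ _))

  runCuts-vanish : ∀ i j m → m ≤ j → runCuts i j m ≡ 0#
  runCuts-vanish i zero    .0 z≤n = runCuts-0 i 0
  runCuts-vanish i (suc j) m  le  =
    trans (runCuts-turning i j m) (turning-vanish (runCuts-vanish i j) m le)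

  -- `turning` shifts the lowest term by one and doubles it; `straight` keeps it.
  runCuts-lead : ∀ i j → runCuts i j (suc j) ≡ pow2 j
  runCuts-lead zero    zero    = +-identityˡ 1#
  runCuts-lead (suc i) zero    = runCuts-lead i zero
  runCuts-lead i       (suc j) = trans (runCuts-turning i j _)
    (cong₂ _+_ (trans (cong₂ _+_ (turning-vanish (runCuts-vanish i j) j (ℕ.n≤1+n j)) (runCuts-lead i j)) (+-identityˡ _))
               (runCuts-lead i j))

  -- t/(1 - t)² begins with t + 2t², and up to the factor tʲ the multipliers are even, so the second
  -- coefficient is twice the first. It takes over on the diagonal when `m` is confined to the
  -- parity of `j`.
  runCuts-lead₂ : ∀ i j → runCuts i j (suc (suc j)) ≡ pow2 (suc j)
  runCuts-lead₂ zero    zero    = cong (_+ 1#) (+-identityˡ 1#)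
  runCuts-lead₂ (suc i) zero    =
    trans (+-congʳ (trans (+-identityˡ _) (runCuts-0 i 0))) (trans (+-identityˡ _) (runCuts-lead₂ i zero))
  runCuts-lead₂ i       (suc j) = trans (runCuts-turning i j _)
    (cong₂ _+_ (trans (cong₂ _+_ (turning-vanish (runCuts-vanish i j) (suc j) ℕ.≤-refl) (runCuts-lead₂ i j)) (+-identityˡ _))
               (runCuts-lead₂ i j))

  -- Triangular systems

  combination : List (R × ℕ) → (ℕ → R) → R
  combination []             f = 0#
  combination ((c , l) ∷ cs) f = (c * f l) + combination cs f

  combination-vanish : ∀ {K f} cs → All (λ cl → proj₂ cl < K) cs → (∀ l → l < K → f l ≡ 0#) → combination cs f ≡ 0#
  combination-vanish []             []        h = refl
  combination-vanish ((c , l) ∷ cs) (l<K ∷ p) h = trans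
    (cong₂ _+_ (trans (cong (c *_) (h l l<K)) (zeroʳ c)) (combination-vanish cs p h)) (+-identityˡ 0#)

  combination-cong : ∀ cs {f g} → (∀ l → f l ≡ g l) → combination cs f ≡ combination cs g
  combination-cong []             h = refl
  combination-cong ((c , l) ∷ cs) h = cong₂ _+_ (cong (c *_) (h l)) (combination-cong cs h)

  -- Back substitution. Among the first `K + 1` columns, row `K` has nothing off the diagonal, which
  -- fixes the coefficient of column `K`; the smaller system is solved after subtracting that column
  -- from the right-hand side.
  triangular-solve : (M : ℕ → ℕ → R) (inv : ℕ → R) →
    (∀ k l → l < k → M k l ≡ 0#) → (∀ k → inv k * M k k ≡ 1#) →
    ∀ K (g : ℕ → R) → ∃ λ cs → All (λ cl → proj₂ cl < K) cs × (∀ k → k < K → combination cs (M k) ≡ g k)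
  triangular-solve M inv vanish invertible zero    g = [] , [] , λ k ()
  triangular-solve M inv vanish invertible (suc K) g
    with triangular-solve M inv vanish invertible K (λ k → (- ((g K * inv K) * M k K)) + g k)
  ... | cs , p , h = (g K * inv K , K) ∷ cs , ℕ.n<1+n K ∷ All.map ℕ.m<n⇒m<1+n p , solve
    where
    c = g K * inv K
    solve : ∀ k → k < suc K → (c * M k K) + combination cs (M k) ≡ g k
    solve k k<1+K with ℕ.m≤n⇒m<n∨m≡n (ℕ.≤-pred k<1+K)
    ... | inj₁ k<K  = begin
      (c * M k K) + combination cs (M k)
        ≡⟨ +-congˡ (h k k<K) ⟩
      (c * M k K) + ((- (c * M k K)) + g k)
        ≡⟨ +-assoc _ _ _ ⟨
      ((c * M k K) + (- (c * M k K))) + g k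
        ≡⟨ cong (_+ g k) (-‿inverseʳ _) ⟩
      0# + g k
        ≡⟨ +-identityˡ _ ⟩
      g k ∎
    ... | inj₂ refl = begin
      ((g K * inv K) * M K K) + combination cs (M K)
        ≡⟨ cong₂ _+_ (*-assoc _ _ _) (combination-vanish cs p (vanish K)) ⟩
      (g K * (inv K * M K K)) + 0#
        ≡⟨ +-identityʳ _ ⟩
      g K * (inv K * M K K)
        ≡⟨ cong (g K *_) (invertible K) ⟩
      g K * 1#
        ≡⟨ *-identityʳ _ ⟩
      g K ∎

  -- Convolution in the group algebra

  module _ {A : Set} where

    ∑ : (A → R) → List A → R
    ∑ f []       = 0#
    ∑ f (x ∷ xs) = f x + ∑ f xs

    ∑-cong : ∀ {f g} xs → (∀ x → x ∈ xs → f x ≡ g x) → ∑ f xs ≡ ∑ g xs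
    ∑-cong []       h = refl
    ∑-cong (x ∷ xs) h = cong₂ _+_ (h x (here refl)) (∑-cong xs (λ y y∈ → h y (there y∈)))

    ∑-+ : ∀ f g xs → ∑ (λ x → f x + g x) xs ≡ ∑ f xs + ∑ g xs
    ∑-+ f g []       = sym (+-identityˡ 0#)
    ∑-+ f g (x ∷ xs) = trans (+-congˡ (∑-+ f g xs)) (interchange _ _ _ _)

    ∑-*ˡ : ∀ c f xs → ∑ (λ x → c * f x) xs ≡ c * ∑ f xs
    ∑-*ˡ c f []       = sym (zeroʳ c)
    ∑-*ˡ c f (x ∷ xs) = trans (+-congˡ (∑-*ˡ c f xs)) (sym (distribˡ c _ _))

    ∑-≡0 : ∀ {f} xs → (∀ x → x ∈ xs → f x ≡ 0#) → ∑ f xs ≡ 0#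
    ∑-≡0 []       h = refl
    ∑-≡0 (x ∷ xs) h = trans (cong₂ _+_ (h x (here refl)) (∑-≡0 xs (λ y y∈ → h y (there y∈)))) (+-identityˡ 0#)

    ∑-swap : ∀ {B : Set} (Λ : (B → R) → R) → Λ (λ _ → 0#) ≡ 0# →
             (∀ f g → Λ (λ b → f b + g b) ≡ Λ f + Λ g) →
             ∀ (g : A → B → R) xs → ∑ (λ x → Λ (g x)) xs ≡ Λ (λ b → ∑ (λ x → g x b) xs)
    ∑-swap Λ Λ-0 Λ-+ g []       = sym Λ-0
    ∑-swap Λ Λ-0 Λ-+ g (x ∷ xs) = trans (+-congˡ (∑-swap Λ Λ-0 Λ-+ g xs)) (sym (Λ-+ _ _))

  ∑-ind : ∀ (f : List ℕ → R) {r xs} → Unique xs → r ∈ xs → ∑ (λ x → ind r x * f x) xs ≡ f r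
  ∑-ind f {r} {x ∷ xs} (x∉xs ∷ xs!) (here refl) = trans (cong₂ _+_
    (trans (*-congʳ (ind-refl r)) (*-identityˡ _))
    (∑-≡0 xs (λ y y∈ → trans (*-congʳ (ind-≢ {r} {y} (All.lookup x∉xs y∈))) (zeroˡ _))))
    (+-identityʳ _)
  ∑-ind f {r} {x ∷ xs} (x∉xs ∷ xs!) (there r∈xs) = trans (cong₂ _+_
    (trans (*-congʳ (ind-≢ {r} {x} (λ r≡x → All.lookup x∉xs r∈xs (sym r≡x)))) (zeroˡ _))
    (∑-ind f xs! r∈xs))
    (+-identityˡ _)

  convolution : ℕ → (List ℕ → R) → (List ℕ → R) → List ℕ → R
  convolution n a b σ = ∑ (λ α → a α * ∑ (λ β → b β * ind (compose α β) σ) (perms n)) (perms n)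

  dealt : ℕ → List Bool → List ℕ → R
  dealt n ε σ = deal ε (λ r → ind r σ) (interval 1 n)

  -- Passes from the coefficients of X(ε) back to the functional `deal ε`.
  ∑-dealt : ∀ n ε f → ∑ (λ β → dealt n ε β * f β) (perms n) ≡ deal ε f (interval 1 n)
  ∑-dealt n ε f = begin
    ∑ (λ β → dealt n ε β * f β) (perms n)
      ≡⟨ ∑-cong (perms n) (λ β _ → deal-*ʳ ε (interval 1 n) _ (f β)) ⟨
    ∑ (λ β → deal ε (λ r → ind r β * f β) (interval 1 n)) (perms n)
      ≡⟨ ∑-swap (λ g → deal ε g (interval 1 n)) (deal-0 ε (interval 1 n)) (deal-+ ε (interval 1 n)) _ (perms n) ⟩
    deal ε (λ r → ∑ (λ β → ind r β * f β) (perms n)) (interval 1 n)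
      ≡⟨ deal-cong ε (interval 1 n) (λ r r↭ → ∑-ind f (perms-Unique n) (↭⇒perms r↭)) ⟩
    deal ε f (interval 1 n) ∎

  -- `compose α β` is `β` relabelled by `α`. If `β` results from dealing 1,...,n, then `compose α β`
  -- results from dealing the deck `α`, so the product amounts to dealing twice.
  dealt-convolution : ∀ n ε δ σ →
    convolution n (dealt n ε) (dealt n δ) σ ≡ dealt n (concatMap (block ε) δ) σ
  dealt-convolution n ε δ σ = begin
    convolution n (dealt n ε) (dealt n δ) σ
      ≡⟨ ∑-dealt n ε _ ⟩
    deal ε (λ α → ∑ (λ β → dealt n δ β * ind (compose α β) σ) (perms n)) (interval 1 n)
      ≡⟨ deal-cong′ ε (interval 1 n) (λ α → ∑-dealt n δ _) ⟩
    deal ε (λ α → deal δ (λ β → ind (compose α β) σ) (interval 1 n)) (interval 1 n)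
      ≡⟨ deal-cong′ ε (interval 1 n) (λ α → deal-map (entry α) δ (λ r → ind r σ) (interval 1 n)) ⟨
    deal ε (λ α → deal δ (λ r → ind r σ) (map (entry α) (interval 1 n))) (interval 1 n)
      ≡⟨ deal-cong ε (interval 1 n) (λ α α↭ → cong (deal δ (λ r → ind r σ)) (begin
           map (entry α) (interval 1 n)
             ≡⟨ cong (λ k → map (entry α) (interval 1 k)) (trans (↭-length α↭) (interval-length 1 n)) ⟨
           map (entry α) (interval 1 (length α))
             ≡⟨ map-entry α ⟩
           α ∎)) ⟩
    deal ε (deal δ (λ r → ind r σ)) (interval 1 n)
      ≡⟨ deal-deal ε δ _ (interval 1 n) ⟩
    dealt n (concatMap (block ε) δ) σ ∎

  -- Spans and functions of a statistic

  module GroupAlgebra (n : ℕ) where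

    _∗_ : (List ℕ → R) → (List ℕ → R) → List ℕ → R
    _∗_ = convolution n

    infix 4 _≋_
    _≋_ : (List ℕ → R) → (List ℕ → R) → Set
    x ≋ y = ∀ σ → σ ∈ perms n → x σ ≡ y σ

    ∗-cong : ∀ {x x′ y y′} → x ≋ x′ → y ≋ y′ → ∀ σ → (x ∗ y) σ ≡ (x′ ∗ y′) σ
    ∗-cong x≋ y≋ σ = ∑-cong (perms n) (λ α α∈ →
      cong₂ _*_ (x≋ α α∈) (∑-cong (perms n) (λ β β∈ → *-congʳ (y≋ β β∈))))

    ∗-distribʳ : ∀ x x′ y σ → ((λ τ → x τ + x′ τ) ∗ y) σ ≡ (x ∗ y) σ + (x′ ∗ y) σ
    ∗-distribʳ x x′ y σ = trans (∑-cong (perms n) (λ α _ → distribʳ _ (x α) (x′ α))) (∑-+ _ _ (perms n))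

    ∗-distribˡ : ∀ x y y′ σ → (x ∗ (λ τ → y τ + y′ τ)) σ ≡ (x ∗ y) σ + (x ∗ y′) σ
    ∗-distribˡ x y y′ σ = trans
      (∑-cong (perms n) (λ α _ → trans
        (*-congˡ (trans (∑-cong (perms n) (λ β _ → distribʳ _ (y β) (y′ β))) (∑-+ _ _ (perms n))))
        (distribˡ (x α) _ _)))
      (∑-+ _ _ (perms n))

    ∗-scaleˡ : ∀ c x y σ → ((λ τ → c * x τ) ∗ y) σ ≡ c * (x ∗ y) σ
    ∗-scaleˡ c x y σ = trans (∑-cong (perms n) (λ α _ → *-assoc c _ _)) (∑-*ˡ c _ (perms n))

    ∗-scaleʳ : ∀ c x y σ → (x ∗ (λ τ → c * y τ)) σ ≡ c * (x ∗ y) σ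
    ∗-scaleʳ c x y σ = trans
      (∑-cong (perms n) (λ α _ → begin
        x α * ∑ (λ β → (c * y β) * ind (compose α β) σ) (perms n)
          ≡⟨ *-congˡ (trans (∑-cong (perms n) (λ β _ → *-assoc c _ _)) (∑-*ˡ c _ (perms n))) ⟩
        x α * (c * ∑ (λ β → y β * ind (compose α β) σ) (perms n))
          ≡⟨ *-assoc (x α) c _ ⟨
        (x α * c) * ∑ (λ β → y β * ind (compose α β) σ) (perms n)
          ≡⟨ *-congʳ (*-comm (x α) c) ⟩
        (c * x α) * ∑ (λ β → y β * ind (compose α β) σ) (perms n)
          ≡⟨ *-assoc c (x α) _ ⟩
        c * (x α * ∑ (λ β → y β * ind (compose α β) σ) (perms n)) ∎))
      (∑-*ˡ c _ (perms n))

    ∗-zeroˡ : ∀ y σ → ((λ _ → 0#) ∗ y) σ ≡ 0#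
    ∗-zeroˡ y σ = ∑-≡0 (perms n) (λ α _ → zeroˡ _)

    ∗-zeroʳ : ∀ x σ → (x ∗ (λ _ → 0#)) σ ≡ 0#
    ∗-zeroʳ x σ = ∑-≡0 (perms n) (λ α _ → trans (*-congˡ (∑-≡0 (perms n) (λ β _ → zeroˡ _))) (zeroʳ _))

    -- Inductive, since the families are infinite and closure under products follows by recursion.
    -- `resp` is there because an element matters only through its values on permutations.
    data Span {J : Set} (f : J → List ℕ → R) : (List ℕ → R) → Set where
      gen   : ∀ j → Span f (f j)
      nil   : Span f (λ _ → 0#)
      add   : ∀ {x y} → Span f x → Span f y → Span f (λ σ → x σ + y σ)
      scale : ∀ c {x} → Span f x → Span f (λ σ → c * x σ)
      resp  : ∀ {x y} → x ≋ y → Span f x → Span f y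

    Span-combination : ∀ {J} {f : J → List ℕ → R} cs {g : ℕ → List ℕ → R} → (∀ l → Span f (g l)) →
                       Span f (λ σ → combination cs (λ l → g l σ))
    Span-combination []             h = nil
    Span-combination ((c , l) ∷ cs) h = add (scale c (h l)) (Span-combination cs h)

    Span-closed : ∀ {J} {f : J → List ℕ → R} → (∀ i j → Span f (f i ∗ f j)) →
                  ∀ {x y} → Span f x → Span f y → Span f (x ∗ y)
    Span-closed {f = f} h = left
      where
      right : ∀ i {y} → Span f y → Span f (f i ∗ y)
      right i (gen j)     = h i j
      right i nil         = resp (λ σ _ → sym (∗-zeroʳ (f i) σ)) nil
      right i (add p q)   = resp (λ σ _ → sym (∗-distribˡ (f i) _ _ σ)) (add (right i p) (right i q))
      right i (scale c p) = resp (λ σ _ → sym (∗-scaleʳ c (f i) _ σ)) (scale c (right i p))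
      right i (resp e p)  = resp (λ σ _ → ∗-cong {f i} {f i} (λ _ _ → refl) e σ) (right i p)
      left : ∀ {x y} → Span f x → Span f y → Span f (x ∗ y)
      left {y = y} (gen i)     r = right i r
      left {y = y} nil         r = resp (λ σ _ → sym (∗-zeroˡ y σ)) nil
      left {y = y} (add p q)   r = resp (λ σ _ → sym (∗-distribʳ _ _ y σ)) (add (left p r) (left q r))
      left {y = y} (scale c p) r = resp (λ σ _ → sym (∗-scaleˡ c _ y σ)) (scale c (left p r))
      left {y = y} (resp e p)  r = resp (λ σ _ → ∗-cong {y = y} {y} e (λ _ _ → refl) σ) (left p r)

    -- Each of the six spaces has a basis of indicators of the values of one statistic, so it
    -- consists of all functions of that statistic.
    FunctionOf : {V : Set} → (List ℕ → V) → (List ℕ → R) → Set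
    FunctionOf {V} st x = ∃ λ (g : V → R) → ∀ σ → σ ∈ perms n → x σ ≡ g (st σ)

    Span-FunctionOf : ∀ {V : Set} {st : List ℕ → V} {J} {f : J → List ℕ → R} →
                      (∀ j → FunctionOf st (f j)) → ∀ {x} → Span f x → FunctionOf st x
    Span-FunctionOf h (gen j)     = h j
    Span-FunctionOf h nil         = (λ _ → 0#) , λ _ _ → refl
    Span-FunctionOf h (add p q)   with Span-FunctionOf h p | Span-FunctionOf h q
    ... | g , e | g′ , e′ = (λ v → g v + g′ v) , λ σ σ∈ → cong₂ _+_ (e σ σ∈) (e′ σ σ∈)
    Span-FunctionOf h (scale c p) with Span-FunctionOf h p
    ... | g , e = (λ v → c * g v) , λ σ σ∈ → *-congˡ (e σ σ∈)
    Span-FunctionOf h (resp e p)  with Span-FunctionOf h p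
    ... | g , e′ = g , λ σ σ∈ → trans (sym (e σ σ∈)) (e′ σ σ∈)

    -- The functions of `st` are also the span of `f`: the first description fits the given
    -- generators, the second one the products.
    FunctionOf-closed : ∀ {V : Set} {st : List ℕ → V} {J} (f : J → List ℕ → R) →
      (∀ {x} → FunctionOf st x → Span f x) → (∀ j → FunctionOf st (f j)) → (∀ i j → Span f (f i ∗ f j)) →
      ∀ {x y} → FunctionOf st x → FunctionOf st y → FunctionOf st (x ∗ y)
    FunctionOf-closed f spans gens closed p q = Span-FunctionOf gens (Span-closed closed (spans p) (spans q))

    A : ℕ → Bool → List ℕ → R
    A m s = dealt n (alternating m s)

    A-∗ : ∀ m s k t σ → (A m s ∗ A k t) σ ≡ A (k ℕ.* m) (s xor (odd m ∧ t)) σ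
    A-∗ m s k t σ = trans (dealt-convolution n (alternating m s) (alternating k t) σ)
      (cong (λ ε → dealt n ε σ) (blocks-alternating m s k t))

  +-cancel : ∀ w g → w + (g + (- w)) ≡ g
  +-cancel w g = begin
    w + (g + (- w)) ≡⟨ +-congˡ (+-comm g _) ⟩
    w + ((- w) + g) ≡⟨ +-assoc w _ g ⟨
    (w + (- w)) + g ≡⟨ +-congʳ (-‿inverseʳ w) ⟩
    0# + g          ≡⟨ +-identityˡ g ⟩
    g ∎

  +-cancel′ : ∀ w g → (g + (- w)) + w ≡ g
  +-cancel′ w g = trans (+-comm _ w) (+-cancel w g)

  -- The six spaces are closed under products

  module RunAlgebras {n M : ℕ} (n≡2+M : n ≡ suc (suc M)) (½ : R) (½+½≡1 : ½ + ½ ≡ 1#) where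

    open GroupAlgebra n

    halves : ℕ → R
    halves zero    = 1#
    halves (suc j) = halves j * ½

    halves-pow2 : ∀ j → halves j * pow2 j ≡ 1#
    halves-pow2 zero    = *-identityˡ 1#
    halves-pow2 (suc j) = begin
      (halves j * ½) * (pow2 j + pow2 j)     ≡⟨ *-assoc _ ½ _ ⟩
      halves j * (½ * (pow2 j + pow2 j))     ≡⟨ *-congˡ (distribˡ ½ _ _) ⟩
      halves j * ((½ * pow2 j) + (½ * pow2 j)) ≡⟨ *-congˡ (distribʳ (pow2 j) ½ ½) ⟨
      halves j * ((½ + ½) * pow2 j)          ≡⟨ *-congˡ (trans (*-congʳ ½+½≡1) (*-identityˡ _)) ⟩
      halves j * pow2 j                      ≡⟨ halves-pow2 j ⟩
      1# ∎

    -- There are `n − 1 = M + 1` steps, and those which are not turns go straight on.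
    coefficient : ℕ → ℕ → R
    coefficient t m = runCuts (suc M ∸ t) t m

    A-coefficient : ∀ m s {σ} → σ ∈ perms n → A m s σ ≡ coefficient (turns s (descents σ)) m
    A-coefficient m s {σ} σ∈ = begin
      A m s σ
        ≡⟨ deal-ind (alternating m s) (interval-sorted 1 n) (perms-Unique-word {n} σ∈) (perms⇒↭ σ∈) ⟩
      cuts (alternating m s) σ
        ≡⟨ nonempty σ (trans (perms-length {n} σ∈) n≡2+M) ⟩
      altCuts m s (descents σ)
        ≡⟨ proj₂ (proj₂ (altCuts-turns (descents σ) s)) m ⟩
      runCuts (proj₁ (altCuts-turns (descents σ) s)) (turns s (descents σ)) m
        ≡⟨ cong (λ i → runCuts i (turns s (descents σ)) m) index ⟩
      coefficient (turns s (descents σ)) m ∎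
      where
      nonempty : ∀ σ → length σ ≡ suc (suc M) → cuts (alternating m s) σ ≡ altCuts m s (descents σ)
      nonempty (x ∷ w) _ = cuts-alternating m s x w
      index : proj₁ (altCuts-turns (descents σ) s) ≡ suc M ∸ turns s (descents σ)
      index = begin
        proj₁ (altCuts-turns (descents σ) s)
          ≡⟨ ℕ.m+n∸n≡m _ (turns s (descents σ)) ⟨
        (proj₁ (altCuts-turns (descents σ) s) ℕ.+ turns s (descents σ)) ∸ turns s (descents σ)
          ≡⟨ cong (_∸ turns s (descents σ))
               (trans (proj₁ (proj₂ (altCuts-turns (descents σ) s))) (perms-length-descents n≡2+M σ∈)) ⟩
        suc M ∸ turns s (descents σ) ∎

    coefficient-parity : ∀ {t} m → t < suc M → odd m ≡ odd t → coefficient t m ≡ coefficient (suc t) m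
    coefficient-parity {t} m (s≤s t≤M) e =
      trans (cong (λ i → runCuts i t m) (ℕ.+-∸-assoc 1 t≤M)) (runCuts-parity (M ∸ t) t m e)

    -- For even `m` the numbers 2k and 2k + 1 of turns are indistinguishable; 2k represents the
    -- pair.
    coefficient-even : ∀ {t} m → t ≤ suc M → odd m ≡ false → coefficient t m ≡ coefficient (double ⌊ t /2⌋) m
    coefficient-even {t} m t≤N e with halfView t
    ... | isEven k = cong (λ h → coefficient (double h) m) (sym (⌊double/2⌋ k))
    ... | isOdd  k = trans (sym (coefficient-parity m t≤N (trans e (sym (odd-double k)))))
                           (cong (λ h → coefficient (double h) m) (sym (⌊1+double/2⌋ k)))

    -- For odd `m` the pairs are 2k - 1 and 2k with k positive, represented by 2k - 1. Zero turns
    -- stand alone, and truncated subtraction makes 0 their representative.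
    coefficient-odd : ∀ {t} m → t ≤ suc M → odd m ≡ true →
                      coefficient t m ≡ coefficient (double ⌊ suc t /2⌋ ∸ 1) m
    coefficient-odd {t} m t≤N e with halfView t
    ... | isEven zero    = refl
    ... | isEven (suc k) = trans (sym (coefficient-parity m t≤N (trans e (cong not (sym (odd-double k))))))
                                 (cong (λ h → coefficient (suc (double h)) m) (sym (⌊1+double/2⌋ k)))
    ... | isOdd  k       = cong (λ h → coefficient (suc (double h)) m) (sym (⌊double/2⌋ k))

    -- One list of coefficients serves both signs, as `s` enters only through the count of turns;
    -- the sums over both signs rely on this. The shift to `suc l` piles makes the matrix
    -- triangular.
    expand : ∀ u → ∃ λ cs → ∀ σ → σ ∈ perms n → ∀ s →
             combination cs (λ l → A (suc l) s σ) ≡ u (turns s (descents σ))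
    expand u with triangular-solve (λ t l → coefficient t (suc l)) halves
                    (λ t l l<t → runCuts-vanish (suc M ∸ t) t (suc l) l<t)
                    (λ t → trans (*-congˡ (runCuts-lead (suc M ∸ t) t)) (halves-pow2 t)) (suc (suc M)) u
    ... | cs , _ , h = cs , λ σ σ∈ s →
      trans (combination-cong cs (λ l → A-coefficient (suc l) s σ∈))
            (h (turns s (descents σ)) (s≤s (perms-turns-≤ n≡2+M σ∈ s)))

    expand-even : ∀ u → ∃ λ cs → ∀ σ → σ ∈ perms n → ∀ s →
                  combination cs (λ l → A (double (suc l)) s σ) ≡ u ⌊ turns s (descents σ) /2⌋
    expand-even u with triangular-solve (λ k l → coefficient (double k) (double (suc l))) (λ k → halves (suc (double k)))
                         (λ k l l<k → runCuts-vanish (suc M ∸ double k) (double k) (double (suc l)) (double-mono l<k))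
                         (λ k → trans (*-congˡ (runCuts-lead₂ (suc M ∸ double k) (double k)))
                                      -- The system covers more values than occur. The triangular
                                      -- shape persists there, since the facts about `runCuts i j`
                                      -- hold for every `i`, also for a truncated one.
                                      (halves-pow2 (suc (double k)))) (suc (suc M)) u
    ... | cs , _ , h = cs , λ σ σ∈ s →
      trans (combination-cong cs (λ l → trans (A-coefficient (double (suc l)) s σ∈)
               (coefficient-even (double (suc l)) (perms-turns-≤ n≡2+M σ∈ s) (odd-double (suc l)))))
            (h ⌊ turns s (descents σ) /2⌋ (s≤s (ℕ.≤-trans (ℕ.⌊n/2⌋≤n _) (perms-turns-≤ n≡2+M σ∈ s))))

    expand-odd : ∀ u → ∃ λ cs → ∀ σ → σ ∈ perms n → ∀ s →
                 combination cs (λ l → A (suc (double l)) s σ) ≡ u ⌊ suc (turns s (descents σ)) /2⌋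
    expand-odd u with triangular-solve (λ k l → coefficient (double k ∸ 1) (suc (double l))) (λ k → halves (double k))
                        vanish diagonal (suc (suc (suc M))) u
      where
      vanish : ∀ k l → l < k → coefficient (double k ∸ 1) (suc (double l)) ≡ 0#
      vanish (suc k) l (s≤s l≤k) =
        runCuts-vanish (M ∸ double k) (suc (double k)) (suc (double l)) (s≤s (double-mono l≤k))
      diagonal : ∀ k → halves (double k) * coefficient (double k ∸ 1) (suc (double k)) ≡ 1#
      -- Zero turns meet one pile, hence the lowest coefficient. All later diagonal entries pair
      -- `j = 2k + 1` turns with `j + 2` piles, hence the second lowest.
      diagonal zero    = trans (*-congˡ (runCuts-lead (suc M ∸ 0) 0)) (halves-pow2 0)
      diagonal (suc k) =
        trans (*-congˡ (runCuts-lead₂ (M ∸ double k) (suc (double k)))) (halves-pow2 (double (suc k)))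
    ... | cs , _ , h = cs , λ σ σ∈ s →
      trans (combination-cong cs (λ l → trans (A-coefficient (suc (double l)) s σ∈)
               (coefficient-odd (suc (double l)) (perms-turns-≤ n≡2+M σ∈ s) (cong not (odd-double l)))))
            (h ⌊ suc (turns s (descents σ)) /2⌋
               (s≤s (ℕ.≤-trans (ℕ.⌊n/2⌋≤n _) (s≤s (perms-turns-≤ n≡2+M σ∈ s)))))

    runs± : List ℕ → ℕ × Bool
    runs± σ = run σ , firstAsc σ

    A-runs± : ∀ m s → FunctionOf runs± (A m s)
    A-runs± m s = (λ (r , b) → coefficient (turnsFrom r b s) m) , λ σ σ∈ →
      trans (A-coefficient m s σ∈) (cong (λ t → coefficient t m) (perms-turns-run n≡2+M σ∈ s))

    A-span : ∀ {J} {f : J → List ℕ → R} s (u : ℕ → R) → (∀ m → Span f (A m s)) → Span f (λ σ → u (turns s (descents σ)))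
    A-span s u h with expand u
    ... | cs , e = resp (λ σ σ∈ → e σ σ∈ s) (Span-combination cs (λ l → h (suc l)))

    runs±-closed : ∀ {x y} → FunctionOf runs± x → FunctionOf runs± y → FunctionOf runs± (x ∗ y)
    runs±-closed = FunctionOf-closed f spans (λ (m , s) → A-runs± m s)
      (λ (m , s) (k , t) → resp (λ σ _ → sym (A-∗ m s k t σ)) (gen (k ℕ.* m , s xor (odd m ∧ t))))
      where
      f : ℕ × Bool → List ℕ → R
      f (m , s) = A m s
      spans : ∀ {x} → FunctionOf runs± x → Span f x
      spans (g , e) = resp
        (λ σ σ∈ → trans (cong₂ (λ a b → u false a + u true b) (perms-turns-run n≡2+M σ∈ false) (perms-turns-run n≡2+M σ∈ true))
                        (trans (solve (run σ) (firstAsc σ) (perms-run-≥ n≡2+M σ∈)) (sym (e σ σ∈))))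
        (add (A-span false (u false) (λ m → gen (m , false))) (A-span true (u true) (λ m → gen (m , true))))
        where
        -- With `r` runs there are `r − 1` turns counted from the direction of the first run and `r`
        -- from the other. Each equation thus gives a value at `r` from a value of the other sign at
        -- `r − 1`; the values at 0 are free.
        u : Bool → ℕ → R
        u s zero    = 0#
        u s (suc r) = g (suc r , s) + (- u (not s) r)
        solve : ∀ r b → 1 ≤ r → u false (turnsFrom r b false) + u true (turnsFrom r b true) ≡ g (r , b)
        solve (suc r) false _ = +-cancel′ (u true r) _
        solve (suc r) true  _ = +-cancel (u false r) _

    Z : ℕ → List ℕ → R
    Z m σ = A m false σ + A m true σ

    Z-∗-A : ∀ m k t σ → (Z m ∗ A k t) σ ≡ Z (k ℕ.* m) σ
    Z-∗-A m k t σ = trans (∗-distribʳ (A m false) (A m true) (A k t) σ)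
      (trans (cong₂ _+_ (A-∗ m false k t σ) (A-∗ m true k t σ)) (both (odd m ∧ t)))
      where
      both : ∀ c → A (k ℕ.* m) (false xor c) σ + A (k ℕ.* m) (true xor c) σ ≡ Z (k ℕ.* m) σ
      both false = refl
      both true  = +-comm _ _

    Z-∗-Z : ∀ m k σ → (Z m ∗ Z k) σ ≡ Z (k ℕ.* m) σ + Z (k ℕ.* m) σ
    Z-∗-Z m k σ = trans (∗-distribˡ (Z m) (A k false) (A k true) σ)
      (cong₂ _+_ (Z-∗-A m k false σ) (Z-∗-A m k true σ))

    -- For odd `m` the sign of the right factor is passed on, so the two summands have opposite
    -- signs. For even `m` they would coincide, which is why C has the single `A m s` only for odd
    -- `m`.
    A-∗-Z : ∀ m s k → odd m ≡ true → ∀ σ → (A m s ∗ Z k) σ ≡ Z (k ℕ.* m) σ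
    A-∗-Z m s k e σ = trans (∗-distribˡ (A m s) (A k false) (A k true) σ)
      (trans (cong₂ _+_ (A-∗ m s k false σ) (A-∗ m s k true σ))
             (trans (cong (λ o → A (k ℕ.* m) (s xor (o ∧ false)) σ + A (k ℕ.* m) (s xor (o ∧ true)) σ) e) (both s)))
      where
      both : ∀ s → A (k ℕ.* m) (s xor false) σ + A (k ℕ.* m) (s xor true) σ ≡ Z (k ℕ.* m) σ
      both false = refl
      both true  = +-comm _ _

    -- Counted from the two signs there are `r − 1` and `r` turns in some order, so the sum over
    -- both signs forgets the direction of the first run.
    Z-runs : ∀ m → FunctionOf run (Z m)
    Z-runs m = (λ r → coefficient (r ∸ 1) m + coefficient r m) , λ σ σ∈ →
      trans (cong₂ _+_ (proj₂ (A-runs± m false) σ σ∈) (proj₂ (A-runs± m true) σ σ∈)) (both (run σ) (firstAsc σ))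
      where
      both : ∀ r b → coefficient (turnsFrom r b false) m + coefficient (turnsFrom r b true) m
                     ≡ coefficient (r ∸ 1) m + coefficient r m
      both r false = +-comm _ _
      both r true  = refl

    combination-+ : ∀ cs f g → combination cs (λ l → f l + g l) ≡ combination cs f + combination cs g
    combination-+ []             f g = sym (+-identityˡ 0#)
    combination-+ ((c , l) ∷ cs) f g =
      trans (cong₂ _+_ (distribˡ c _ _) (combination-+ cs f g)) (interchange _ _ _ _)

    run-closed : ∀ {x y} → FunctionOf run x → FunctionOf run y → FunctionOf run (x ∗ y)
    run-closed = FunctionOf-closed Z spans Z-runs
      (λ m k → resp (λ σ _ → sym (Z-∗-Z m k σ)) (add (gen (k ℕ.* m)) (gen (k ℕ.* m))))
      where
      Z-span : ∀ u → Span Z (λ σ → u (turns false (descents σ)) + u (turns true (descents σ)))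
      Z-span u with expand u
      ... | cs , h = resp
        (λ σ σ∈ → trans (combination-+ cs _ _) (cong₂ _+_ (h σ σ∈ false) (h σ σ∈ true)))
        (Span-combination cs (λ l → gen (suc l)))
      spans : ∀ {x} → FunctionOf run x → Span Z x
      spans (g , e) = resp
        (λ σ σ∈ → trans (cong₂ (λ a b → u a + u b) (perms-turns-run n≡2+M σ∈ false) (perms-turns-run n≡2+M σ∈ true))
                        (trans (solve (run σ) (firstAsc σ) (perms-run-≥ n≡2+M σ∈)) (sym (e σ σ∈))))
        (Z-span u)
        where
        -- One function serves both signs here: `u (r − 1) + u r = g r` is solved upwards from
        -- `u 0 = 0`.
        u : ℕ → R
        u zero    = 0#
        u (suc r) = g (suc r) + (- u r)
        solve : ∀ r b → 1 ≤ r → u (turnsFrom r b false) + u (turnsFrom r b true) ≡ g r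
        solve (suc r) false _ = +-cancel′ (u r) _
        solve (suc r) true  _ = +-cancel (u r) _

    runL-closed : ∀ {x y} → FunctionOf runL x → FunctionOf runL y → FunctionOf runL (x ∗ y)
    runL-closed = FunctionOf-closed f spans gens
      (λ m k → resp (λ σ _ → sym (trans (A-∗ m false k false σ) (sign m k σ))) (gen (k ℕ.* m)))
      where
      f : ℕ → List ℕ → R
      f m = A m false
      sign : ∀ m k σ → A (k ℕ.* m) (odd m ∧ false) σ ≡ A (k ℕ.* m) false σ
      sign m k σ with odd m
      ... | false = refl
      ... | true  = refl
      gens : ∀ m → FunctionOf runL (f m)
      gens m = (λ r → coefficient (r ∸ 1) m) , λ σ σ∈ →
        trans (A-coefficient m false σ∈) (cong (λ r → coefficient (r ∸ 1) m) (sym (perms-runL n≡2+M σ∈)))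
      spans : ∀ {x} → FunctionOf runL x → Span f x
      spans (g , e) = resp
        (λ σ σ∈ → trans (cong g (sym (perms-runL n≡2+M σ∈))) (sym (e σ σ∈)))
        (A-span false (λ t → g (suc t)) gen)

    -- For even `m` the coefficients depend on the turns counted from - only through their half
    -- rounded down, the number of peaks. Evenness also lets the sign - of the left factor survive
    -- in the product.
    peaks-closed : ∀ {x y} → FunctionOf peaks x → FunctionOf peaks y → FunctionOf peaks (x ∗ y)
    peaks-closed = FunctionOf-closed f spans gens closed
      where
      f : (∃ λ m → odd m ≡ false) → List ℕ → R
      f (m , _) = A m true
      gens : ∀ j → FunctionOf peaks (f j)
      gens (m , m-even) = (λ k → coefficient (double k) m) , λ σ σ∈ →
        trans (A-coefficient m true σ∈)
          (trans (coefficient-even m (perms-turns-≤ n≡2+M σ∈ true) m-even)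
                 (cong (λ k → coefficient (double k) m) (sym (perms-peaks {n} σ∈))))
      spans : ∀ {x} → FunctionOf peaks x → Span f x
      spans (g , e) with expand-even g
      ... | cs , h = resp
        (λ σ σ∈ → trans (h σ σ∈ true) (trans (cong g (sym (perms-peaks {n} σ∈))) (sym (e σ σ∈))))
        (Span-combination cs (λ l → gen (double (suc l) , odd-double (suc l))))
      closed : ∀ i j → Span f (f i ∗ f j)
      closed (m , m-even) (k , k-even) = resp
        (λ σ _ → sym (trans (A-∗ m true k true σ) (cong (λ o → A (k ℕ.* m) (true xor (o ∧ true)) σ) m-even)))
        (gen (k ℕ.* m , trans (odd-* k m) (cong (_∧ odd m) k-even)))

    -- For odd `m` the coefficients depend on the turns counted from + only through their half
    -- rounded up, the number of left peaks.
    peaksL-closed : ∀ {x y} → FunctionOf peaksL x → FunctionOf peaksL y → FunctionOf peaksL (x ∗ y)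
    peaksL-closed = FunctionOf-closed f spans gens closed
      where
      f : (∃ λ m → odd m ≡ true) → List ℕ → R
      f (m , _) = A m false
      gens : ∀ j → FunctionOf peaksL (f j)
      gens (m , m-odd) = (λ k → coefficient (double k ∸ 1) m) , λ σ σ∈ →
        trans (A-coefficient m false σ∈)
          (trans (coefficient-odd m (perms-turns-≤ n≡2+M σ∈ false) m-odd)
                 (cong (λ k → coefficient (double k ∸ 1) m) (sym (perms-peaksL n≡2+M σ∈))))
      spans : ∀ {x} → FunctionOf peaksL x → Span f x
      spans (g , e) with expand-odd g
      ... | cs , h = resp
        (λ σ σ∈ → trans (h σ σ∈ false) (trans (cong g (sym (perms-peaksL n≡2+M σ∈))) (sym (e σ σ∈))))
        (Span-combination cs (λ l → gen (suc (double l) , cong not (odd-double l))))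
      closed : ∀ i j → Span f (f i ∗ f j)
      closed (m , m-odd) (k , k-odd) = resp
        (λ σ _ → sym (trans (A-∗ m false k false σ) (cong (λ o → A (k ℕ.* m) (o ∧ false) σ) m-odd)))
        (gen (k ℕ.* m , trans (odd-* k m) (cong₂ _∧_ k-odd m-odd)))

    -- The direction of the first run matters only if the number of runs is odd.
    runsC : List ℕ → ℕ × Bool
    runsC σ = run σ , not (odd (run σ)) ∨ firstAsc σ

    runsC-closed : ∀ {x y} → FunctionOf runsC x → FunctionOf runsC y → FunctionOf runsC (x ∗ y)
    runsC-closed = FunctionOf-closed f spans gens closed
      where
      f : (∃ λ m → odd m ≡ true) × Bool ⊎ (∃ λ m → odd m ≡ false) → List ℕ → R
      f (inj₁ ((m , _) , s)) = A m s
      f (inj₂ (m , _))       = Z m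

      gens : ∀ j → FunctionOf runsC (f j)
      gens (inj₂ (m , _)) with Z-runs m
      ... | g , e = (λ (r , _) → g r) , e
      gens (inj₁ ((m , m-odd) , s)) = (λ (r , b) → coefficient (turnsFrom r b s) m) , λ σ σ∈ →
        trans (proj₂ (A-runs± m s) σ σ∈)
              (normalise (run σ) (firstAsc σ) s (perms-run-≥ n≡2+M σ∈) (perms-run-≤ n≡2+M σ∈))
        where
        -- For odd `m` and even `r` the counts `r − 1` and `r` are indistinguishable, so the
        -- direction of the first run drops out.
        equal : ∀ r → 1 ≤ r → r ≤ suc M → odd r ≡ false → coefficient (r ∸ 1) m ≡ coefficient r m
        equal (suc r) _ r<N e = coefficient-parity m r<N (trans m-odd (not-injective (sym e)))
        normalise : ∀ r b s → 1 ≤ r → r ≤ suc M →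
          coefficient (turnsFrom r b s) m ≡ coefficient (turnsFrom r (not (odd r) ∨ b) s) m
        normalise r b s r≥1 r≤N with odd r in e
        normalise r b     s     r≥1 r≤N | true  = refl
        normalise r true  s     r≥1 r≤N | false = refl
        normalise r false false r≥1 r≤N | false = sym (equal r r≥1 r≤N e)
        normalise r false true  r≥1 r≤N | false = equal r r≥1 r≤N e

      closed : ∀ i j → Span f (f i ∗ f j)
      closed (inj₁ ((m , m-odd) , s)) (inj₁ ((k , k-odd) , t)) = resp (λ σ _ → sym (A-∗ m s k t σ))
        (gen (inj₁ ((k ℕ.* m , trans (odd-* k m) (cong₂ _∧_ k-odd m-odd)) , s xor (odd m ∧ t))))
      closed (inj₁ ((m , m-odd) , s)) (inj₂ (k , k-even)) = resp (λ σ _ → sym (A-∗-Z m s k m-odd σ))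
        (gen (inj₂ (k ℕ.* m , trans (odd-* k m) (cong (_∧ odd m) k-even))))
      closed (inj₂ (m , m-even)) (inj₁ ((k , _) , t)) = resp (λ σ _ → sym (Z-∗-A m k t σ))
        (gen (inj₂ (k ℕ.* m , odd-*-even k m m-even)))
      closed (inj₂ (m , m-even)) (inj₂ (k , _)) = resp (λ σ _ → sym (Z-∗-Z m k σ))
        (add (gen (inj₂ (k ℕ.* m , odd-*-even k m m-even))) (gen (inj₂ (k ℕ.* m , odd-*-even k m m-even))))

      A-odd-span : ∀ s u → Span f (λ σ → u ⌊ suc (turns s (descents σ)) /2⌋)
      A-odd-span s u with expand-odd u
      ... | cs , h = resp (λ σ σ∈ → h σ σ∈ s)
        (Span-combination cs (λ l → gen (inj₁ ((suc (double l) , cong not (odd-double l)) , s))))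

      Z-even-span : ∀ u → Span f (λ σ → u ⌊ turns false (descents σ) /2⌋ + u ⌊ turns true (descents σ) /2⌋)
      Z-even-span u with expand-even u
      ... | cs , h = resp
        (λ σ σ∈ → trans (combination-+ cs _ _) (cong₂ _+_ (h σ σ∈ false) (h σ σ∈ true)))
        (Span-combination cs (λ l → gen (inj₂ (double (suc l) , odd-double (suc l)))))

      spans : ∀ {x} → FunctionOf runsC x → Span f x
      spans (g , e) = resp
        (λ σ σ∈ → trans (cong₂ total (perms-turns-run n≡2+M σ∈ false) (perms-turns-run n≡2+M σ∈ true))
                        (trans (solve (run σ) (firstAsc σ) (perms-run-≥ n≡2+M σ∈)) (sym (e σ σ∈))))
        (add (add (A-odd-span false a) (A-odd-span true b)) (Z-even-span p))
        where
        -- Solved for the numbers of runs 2k + 1 and 2k + 2 in turn.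
        a b p : ℕ → R
        a zero    = 0#
        a (suc k) = g (suc (double k) , false) + (- (b k + (p k + p k)))
        b zero    = 0#
        b (suc k) = g (suc (double k) , true) + (- (a k + (p k + p k)))
        p zero    = 0#
        p (suc k) = g (double (suc k) , true) + (- ((a (suc k) + b (suc k)) + p k))

        -- `t` and `t′` are the turns counted from + and from -. For 2k + 2 runs both directions
        -- yield the same equation, in accordance with the single value of `g` there.
        total : ℕ → ℕ → R
        total t t′ = (a ⌊ suc t /2⌋ + b ⌊ suc t′ /2⌋) + (p ⌊ t /2⌋ + p ⌊ t′ /2⌋)

        solve : ∀ r c → 1 ≤ r →
          total (turnsFrom r c false) (turnsFrom r c true) ≡ g (r , not (odd r) ∨ c)
        solve r c r≥1 with halfView r
        solve .(double (suc k)) c r≥1 | isEven (suc k) rewrite odd-double k = go c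
          where
          go : ∀ c → total (turnsFrom (double (suc k)) c false) (turnsFrom (double (suc k)) c true) ≡ g (double (suc k) , true)
          go false rewrite ⌊double/2⌋ k | ⌊1+double/2⌋ k =
            trans (+-congˡ (+-comm _ _)) (trans (sym (+-assoc _ _ _)) (+-cancel _ _))
          go true  rewrite ⌊double/2⌋ k | ⌊1+double/2⌋ k =
            trans (sym (+-assoc _ _ _)) (+-cancel _ _)
        solve .(suc (double k)) c r≥1 | isOdd k rewrite odd-double k = go c
          where
          go : ∀ c → total (turnsFrom (suc (double k)) c false) (turnsFrom (suc (double k)) c true) ≡ g (suc (double k) , c)
          go false rewrite ⌊double/2⌋ k | ⌊1+double/2⌋ k =
            trans (+-assoc _ _ _) (+-cancel′ _ _)
          go true  rewrite ⌊double/2⌋ k | ⌊1+double/2⌋ k =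
            trans (xy∙z≈xz∙y _ _ _) (+-cancel _ _)

-- Spans over the rationals

open Dealing ℚ.+-*-isCommutativeRing

open CommutativeSemigroupProperties (CommutativeMonoid.commutativeSemigroup ℚ.+-0-commutativeMonoid)
  using (interchange)

sumL-++ : ∀ xs ys → sumL (xs ++ ys) ≡ sumL xs + sumL ys
sumL-++ []       ys = sym (ℚ.+-identityˡ (sumL ys))
sumL-++ (x ∷ xs) ys = trans (cong (x +_) (sumL-++ xs ys)) (sym (ℚ.+-assoc x (sumL xs) (sumL ys)))

sumL-map : ∀ {A : Set} (f : A → ℚ) xs → sumL (map f xs) ≡ ∑ f xs
sumL-map f []       = refl
sumL-map f (x ∷ xs) = cong (f x +_) (sumL-map f xs)

sumL-concatMap : ∀ {A : Set} (f : A → List ℚ) xs → sumL (concatMap f xs) ≡ ∑ (λ x → sumL (f x)) xs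
sumL-concatMap f []       = refl
sumL-concatMap f (x ∷ xs) =
  trans (sumL-++ (f x) (concatMap f xs)) (cong (sumL (f x) +_) (sumL-concatMap f xs))

mul-convolution : ∀ n x y σ → mul n x y σ ≡ convolution n x y σ
mul-convolution n x y σ = trans (sumL-concatMap (λ α → map (term α) (perms n)) (perms n))
  (∑-cong (perms n) (λ α _ → begin
    sumL (map (term α) (perms n))
      ≡⟨ sumL-map (term α) (perms n) ⟩
    ∑ (term α) (perms n)
      ≡⟨ ∑-cong (perms n) (λ β _ → factor (x α) (y β) (eqList (compose α β) σ)) ⟩
    ∑ (λ β → x α * (y β * ind (compose α β) σ)) (perms n)
      ≡⟨ ∑-*ˡ (x α) (λ β → y β * ind (compose α β) σ) (perms n) ⟩
    x α * ∑ (λ β → y β * ind (compose α β) σ) (perms n) ∎))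
  where
  term : List ℕ → List ℕ → ℚ
  term α β = if eqList (compose α β) σ then x α * y β else 0ℚ
  factor : ∀ a b e → (if e then a * b else 0ℚ) ≡ a * (b * bit e)
  factor a b true  = cong (a *_) (sym (ℚ.*-identityʳ b))
  factor a b false = sym (trans (cong (a *_) (ℚ.*-zeroʳ b)) (ℚ.*-zeroʳ a))

sumFin-0 : ∀ m (f : Fin m → ℚ) → sumFin m (λ i → 0ℚ * f i) ≡ 0ℚ
sumFin-0 zero    f = refl
sumFin-0 (suc m) f = cong₂ _+_ (ℚ.*-zeroˡ (f Fin.zero)) (sumFin-0 m (λ i → f (Fin.suc i)))

sumFin-+ : ∀ m (c d f : Fin m → ℚ) →
  sumFin m (λ i → (c i + d i) * f i) ≡ sumFin m (λ i → c i * f i) + sumFin m (λ i → d i * f i)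
sumFin-+ zero    c d f = refl
sumFin-+ (suc m) c d f = trans
  (cong₂ _+_ (ℚ.*-distribʳ-+ (f Fin.zero) (c Fin.zero) (d Fin.zero))
             (sumFin-+ m (λ i → c (Fin.suc i)) (λ i → d (Fin.suc i)) (λ i → f (Fin.suc i))))
  (interchange (c Fin.zero * f Fin.zero) (d Fin.zero * f Fin.zero) _ _)

sumFin-* : ∀ m a (c f : Fin m → ℚ) → sumFin m (λ i → (a * c i) * f i) ≡ a * sumFin m (λ i → c i * f i)
sumFin-* zero    a c f = sym (ℚ.*-zeroʳ a)
sumFin-* (suc m) a c f = trans
  (cong₂ _+_ (ℚ.*-assoc a (c Fin.zero) (f Fin.zero)) (sumFin-* m a (λ i → c (Fin.suc i)) (λ i → f (Fin.suc i))))
  (sym (ℚ.*-distribˡ-+ a (c Fin.zero * f Fin.zero) _))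

module _ (n : ℕ) where

  open GroupAlgebra n using (FunctionOf)

  InSpan-nil : ∀ {G} {x : Elem} → (∀ σ → σ ∈ perms n → x σ ≡ 0ℚ) → InSpan n G x
  InSpan-nil {G} h = (λ _ → 0ℚ) , λ σ σ∈ → trans (h σ σ∈) (sym (sumFin-0 (length G) (λ i → lookup G i σ)))

  InSpan-member : ∀ {G} {y : Elem} → y ∈ G → InSpan n G y
  InSpan-member {G} {y} y∈G = coeff y∈G , λ σ _ → sym (value y∈G σ)
    where
    coeff : ∀ {G y} → y ∈ G → Fin (length G) → ℚ
    coeff (here _)    Fin.zero    = 1ℚ
    coeff (here _)    (Fin.suc i) = 0ℚ
    coeff (there y∈G) Fin.zero    = 0ℚ
    coeff (there y∈G) (Fin.suc i) = coeff y∈G i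
    value : ∀ {G : List Elem} {y} (y∈G : y ∈ G) σ → sumFin (length G) (λ i → coeff y∈G i * lookup G i σ) ≡ y σ
    value {y ∷ G} (here refl) σ = trans
      (cong₂ _+_ (ℚ.*-identityˡ (y σ)) (sumFin-0 (length G) (λ i → lookup G i σ))) (ℚ.+-identityʳ (y σ))
    value {z ∷ G} {y} (there y∈G) σ = trans (cong₂ _+_ (ℚ.*-zeroˡ (z σ)) (value y∈G σ)) (ℚ.+-identityˡ (y σ))

  InSpan-combine : ∀ {G} {x y z : Elem} a → InSpan n G y → InSpan n G z →
                   (∀ σ → σ ∈ perms n → x σ ≡ a * y σ + z σ) → InSpan n G x
  InSpan-combine {G} a (c , p) (d , q) h = (λ i → a * c i + d i) , λ σ σ∈ → trans (h σ σ∈) (trans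
    (cong₂ _+_ (trans (cong (a *_) (p σ σ∈)) (sym (sumFin-* (length G) a c (λ i → lookup G i σ)))) (q σ σ∈))
    (sym (sumFin-+ (length G) (λ i → a * c i) d (λ i → lookup G i σ))))

  InSpan⇒FunctionOf : ∀ {V : Set} {st : List ℕ → V} G → (∀ y → y ∈ G → FunctionOf st y) →
                      ∀ {x} → InSpan n G x → FunctionOf st x
  InSpan⇒FunctionOf {st = st} G h (c , e) with function G h c
    where
    function : ∀ G → (∀ y → y ∈ G → FunctionOf st y) → ∀ (c : Fin (length G) → ℚ) →
               FunctionOf st (λ σ → sumFin (length G) (λ i → c i * lookup G i σ))
    function []      h c = (λ _ → 0ℚ) , λ _ _ → refl
    function (y ∷ G) h c with h y (here refl) | function G (λ z z∈G → h z (there z∈G)) (λ i → c (Fin.suc i))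
    ... | g , p | g′ , p′ = (λ v → c Fin.zero * g v + g′ v) , λ σ σ∈ →
      cong₂ _+_ (cong (c Fin.zero *_) (p σ σ∈)) (p′ σ σ∈)
  ... | g , e′ = g , λ σ σ∈ → trans (e σ σ∈) (e′ σ σ∈)

  -- Runs through all permutations and splits off the indicator of the value of each. The invariant
  -- `covers` says that a value is still to come or `g` already vanishes on it.
  FunctionOf⇒InSpan : ∀ {V : Set} {st : List ℕ → V} (eq : V → V → Bool) →
    (∀ v → eq v v ≡ true) → (∀ v w → eq v w ≡ true → v ≡ w) →
    ∀ G → (∀ σ → σ ∈ perms n → ∃ λ y → y ∈ G × (∀ τ → τ ∈ perms n → y τ ≡ bit (eq (st τ) (st σ)))) →
    ∀ {x} → FunctionOf st x → InSpan n G x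
  FunctionOf⇒InSpan {V} {st} eq eq-refl eq-sound G classes (g , e) =
    go (perms n) (All.tabulate (λ z → z)) g e (λ τ τ∈ → inj₁ (Any.map (cong st) τ∈))
    where
    go : ∀ ks → All (_∈ perms n) ks → ∀ g {x : Elem} → (∀ σ → σ ∈ perms n → x σ ≡ g (st σ)) →
         (∀ τ → τ ∈ perms n → Any (λ σ → st τ ≡ st σ) ks ⊎ g (st τ) ≡ 0ℚ) → InSpan n G x
    go [] [] g e covers = InSpan-nil {G} zero-outside
      where
      zero-outside : ∀ σ → σ ∈ perms n → _ ≡ 0ℚ
      zero-outside σ σ∈ with covers σ σ∈
      ... | inj₂ z = trans (e σ σ∈) z
    go (σ ∷ ks) (σ∈ ∷ ks∈) g e covers with classes σ σ∈
    ... | y , y∈G , y-class = InSpan-combine {G} (g (st σ)) (InSpan-member y∈G)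
      (go ks ks∈ g′ (λ _ _ → refl) covers′)
      (λ τ τ∈ → trans (e τ τ∈) (trans (split (st τ)) (cong (λ t → g (st σ) * t + g′ (st τ)) (sym (y-class τ τ∈)))))
      where
      -- With `g` reset to zero on the value just treated, later permutations with the same value
      -- contribute nothing.
      g′ : V → ℚ
      g′ v = if eq v (st σ) then 0ℚ else g v
      split : ∀ v → g v ≡ g (st σ) * bit (eq v (st σ)) + g′ v
      split v with eq v (st σ) in v≡
      ... | true  = trans (cong g (eq-sound v (st σ) v≡)) (sym (trans (ℚ.+-identityʳ _) (ℚ.*-identityʳ (g (st σ)))))
      ... | false = sym (trans (cong (_+ g v) (ℚ.*-zeroʳ (g (st σ)))) (ℚ.+-identityˡ (g v)))
      covers′ : ∀ τ → τ ∈ perms n → Any (λ σ → st τ ≡ st σ) ks ⊎ g′ (st τ) ≡ 0ℚ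
      covers′ τ τ∈ with eq (st τ) (st σ) in v≡ | covers τ τ∈
      ... | true  | _                  = inj₂ refl
      ... | false | inj₂ z             = inj₂ z
      ... | false | inj₁ (there p)     = inj₁ p
      ... | false | inj₁ (here τ≡σ)    = contradiction
        (trans (sym v≡) (trans (cong (λ v → eq v (st σ)) τ≡σ) (eq-refl (st σ)))) λ ()

  FunctionOf-factor : ∀ {V V′ : Set} {st : List ℕ → V} {st′ : List ℕ → V′} (h : V′ → V) →
    (∀ σ → σ ∈ perms n → st σ ≡ h (st′ σ)) → ∀ {x} → FunctionOf st x → FunctionOf st′ x
  FunctionOf-factor h p (g , e) = (λ v → g (h v)) , λ σ σ∈ → trans (e σ σ∈) (cong g (p σ σ∈))

eqBools-refl : ∀ ds → eqBools ds ds ≡ true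
eqBools-refl []           = refl
eqBools-refl (false ∷ ds) = eqBools-refl ds
eqBools-refl (true ∷ ds)  = eqBools-refl ds

eqBools-sound : ∀ ds es → eqBools ds es ≡ true → ds ≡ es
eqBools-sound []           []           e = refl
eqBools-sound (false ∷ ds) (false ∷ es) e = cong (false ∷_) (eqBools-sound ds es e)
eqBools-sound (true ∷ ds)  (true ∷ es)  e = cong (true ∷_) (eqBools-sound ds es e)

∈-boolLists : ∀ ds → ds ∈ boolLists (length ds)
∈-boolLists []           = here refl
∈-boolLists (true ∷ ds)  = ∈-++⁺ˡ (∈-map⁺ (true ∷_) (∈-boolLists ds))
∈-boolLists (false ∷ ds) = ∈-++⁺ʳ _ (∈-map⁺ (false ∷_) (∈-boolLists ds))

-- For a fixed `b′` the test reduces to the condition that defines `W⁺` or `W⁻`.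
eqRuns : ℕ × Bool → ℕ × Bool → Bool
eqRuns (r , b) (r′ , b′) = (r ≡ᵇ r′) ∧ (if b′ then b else not b)

eqRuns-refl : ∀ v → eqRuns v v ≡ true
eqRuns-refl (r , false) = cong (_∧ true) (≡ᵇ-refl r)
eqRuns-refl (r , true)  = cong (_∧ true) (≡ᵇ-refl r)

eqRuns-sound : ∀ v w → eqRuns v w ≡ true → v ≡ w
eqRuns-sound (r , b) (r′ , b′) e with r ≡ᵇ r′ in r≡
eqRuns-sound (r , false) (r′ , false) e | true = cong (_, false) (≡ᵇ-sound r r′ r≡)
eqRuns-sound (r , true)  (r′ , true)  e | true = cong (_, true) (≡ᵇ-sound r r′ r≡)

2*≡double : ∀ k → 2 ℕ.* k ≡ double k
2*≡double zero    = refl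
2*≡double (suc k) = cong suc (trans (ℕ.+-suc k (k ℕ.+ 0)) (cong suc (2*≡double k)))

double-≤⇒≤/2 : ∀ {k m} → double k ≤ m → k ≤ m / 2
double-≤⇒≤/2 {k} {m} le = subst (_≤ m / 2) (m*n/n≡m k 2)
  (/-monoˡ-≤ 2 (subst (_≤ m) (trans (sym (2*≡double k)) (ℕ.*-comm 2 k)) le))

double-⌊/2⌋-≤ : ∀ t → double ⌊ t /2⌋ ≤ t
double-⌊/2⌋-≤ zero          = z≤n
double-⌊/2⌋-≤ (suc zero)    = z≤n
double-⌊/2⌋-≤ (suc (suc t)) = s≤s (s≤s (double-⌊/2⌋-≤ t))

∧-congˡ : ∀ {e a b} → (e ≡ true → a ≡ b) → e ∧ a ≡ e ∧ b
∧-congˡ {true}  h = h refl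
∧-congˡ {false} h = refl

-- From the given generators to functions of statistics and back

module Subalgebras {n M : ℕ} (n≡2+M : n ≡ suc (suc M)) where

  open GroupAlgebra n using (FunctionOf; _∗_)
  open RunAlgebras n≡2+M ½ refl

  n∸1≡1+M : n ∸ 1 ≡ suc M
  n∸1≡1+M = cong (_∸ 1) n≡2+M

  -- Once both spans are spaces of functions of a statistic, inclusion means that the one statistic
  -- is determined by the other.
  subalgebra : ∀ {V V′ : Set} {st : List ℕ → V} {st′ : List ℕ → V′} G H →
    (∀ {x} → InSpan n G x → FunctionOf st x) → (∀ {x} → FunctionOf st x → InSpan n G x) →
    (∀ {x} → FunctionOf st x → FunctionOf st′ x) → (∀ {x} → FunctionOf st′ x → InSpan n H x) →
    (∀ {x y} → FunctionOf st x → FunctionOf st y → FunctionOf st (x ∗ y)) → SubalgebraOf n G H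
  subalgebra {st = st} G H to from coarser from′ closed =
    (λ x p → from′ (coarser (to p))) , λ x y p q → from (multiply x y (closed (to p) (to q)))
    where
    multiply : ∀ x y → FunctionOf st (x ∗ y) → FunctionOf st (mul n x y)
    multiply x y (g , e) = g , λ σ σ∈ → trans (mul-convolution n x y σ) (e σ σ∈)

  descents⇒genD : ∀ {x} → FunctionOf descents x → InSpan n (genD n) x
  descents⇒genD = FunctionOf⇒InSpan n eqBools eqBools-refl eqBools-sound (genD n) λ σ σ∈ →
    B (descents σ) ,
    ∈-map⁺ B (subst (λ k → descents σ ∈ boolLists k)
      (trans (perms-length-descents n≡2+M σ∈) (sym n∸1≡1+M)) (∈-boolLists (descents σ))) ,
    λ τ _ → refl

  runs±⇒descents : ∀ {x} → FunctionOf runs± x → FunctionOf descents x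
  runs±⇒descents = FunctionOf-factor n (λ ds → blocks ds , ascends ds) λ σ σ∈ →
    cong (run σ ,_) (first σ (perms-Unique-word {n} σ∈))
    where
    ascends : List Bool → Bool
    ascends []      = false
    ascends (d ∷ _) = not d
    first : ∀ σ → Unique σ → firstAsc σ ≡ ascends (descents σ)
    first []          _               = refl
    first (x ∷ [])    _               = refl
    first (x ∷ y ∷ w) ((x≢y ∷ _) ∷ _) = <ᵇ-flip x≢y

  run∈range : ∀ {σ} → σ ∈ perms n → run σ ∈ range 1 (n ∸ 1)
  run∈range {σ} σ∈ = ∈-range (perms-run-≥ n≡2+M σ∈) (subst (run σ ≤_) (sym n∸1≡1+M) (perms-run-≤ n≡2+M σ∈))

  genW±⇒runs± : ∀ {x} → InSpan n (genW± n) x → FunctionOf runs± x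
  genW±⇒runs± = InSpan⇒FunctionOf n (genW± n) λ y y∈ → generator (find (∈-concatMap⁻ _ y∈))
    where
    generator : ∀ {y} → (∃ λ k → k ∈ range 1 (n ∸ 1) × y ∈ W⁺ k ∷ W⁻ k ∷ []) → FunctionOf runs± y
    generator (k , _ , here refl)         = (λ (r , b) → bit ((r ≡ᵇ k) ∧ b)) , λ _ _ → refl
    generator (k , _ , there (here refl)) = (λ (r , b) → bit ((r ≡ᵇ k) ∧ not b)) , λ _ _ → refl

  runs±⇒genW± : ∀ {x} → FunctionOf runs± x → InSpan n (genW± n) x
  runs±⇒genW± = FunctionOf⇒InSpan n eqRuns eqRuns-refl eqRuns-sound (genW± n) λ σ σ∈ → class σ (run∈range σ∈)
    where
    class : ∀ σ → run σ ∈ range 1 (n ∸ 1) →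
            ∃ λ y → y ∈ genW± n × (∀ τ → τ ∈ perms n → y τ ≡ bit (eqRuns (runs± τ) (runs± σ)))
    class σ r∈ with firstAsc σ
    ... | true  = W⁺ (run σ) , ∈-concatMap⁺ _ (lose r∈ (here refl)) , λ _ _ → refl
    ... | false = W⁻ (run σ) , ∈-concatMap⁺ _ (lose r∈ (there (here refl))) , λ _ _ → refl

  genMap⇒ : ∀ (stat : List ℕ → ℕ) ks {x} →
            InSpan n (map (λ k → sumOf (λ σ → stat σ ≡ᵇ k)) ks) x → FunctionOf stat x
  genMap⇒ stat ks = InSpan⇒FunctionOf n _ λ y y∈ → generator (∈-map⁻ _ y∈)
    where
    generator : ∀ {y} → (∃ λ k → k ∈ ks × y ≡ sumOf (λ σ → stat σ ≡ᵇ k)) → FunctionOf stat y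
    generator (k , _ , refl) = (λ r → bit (r ≡ᵇ k)) , λ _ _ → refl

  ⇒genMap : ∀ (stat : List ℕ → ℕ) ks → (∀ {σ} → σ ∈ perms n → stat σ ∈ ks) →
            ∀ {x} → FunctionOf stat x → InSpan n (map (λ k → sumOf (λ σ → stat σ ≡ᵇ k)) ks) x
  ⇒genMap stat ks stat∈ = FunctionOf⇒InSpan n _≡ᵇ_ ≡ᵇ-refl ≡ᵇ-sound _ λ σ σ∈ →
    sumOf (λ τ → stat τ ≡ᵇ stat σ) , ∈-map⁺ (λ k → sumOf (λ σ → stat σ ≡ᵇ k)) (stat∈ σ∈) , λ _ _ → refl

  runL∈range : ∀ {σ} → σ ∈ perms n → runL σ ∈ range 1 n
  runL∈range {σ} σ∈ = subst (_∈ range 1 n) (sym (perms-runL n≡2+M σ∈))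
    (∈-range (s≤s z≤n) (subst (_ ≤_) (sym n≡2+M) (s≤s (perms-turns-≤ n≡2+M σ∈ false))))

  peaks∈range : ∀ {σ} → σ ∈ perms n → peaks σ ∈ range 0 ((n ∸ 1) / 2)
  peaks∈range {σ} σ∈ = subst (_∈ range 0 ((n ∸ 1) / 2)) (sym (perms-peaks {n} σ∈))
    (∈-range z≤n (double-≤⇒≤/2 (ℕ.≤-trans (double-⌊/2⌋-≤ _)
      (subst (turns true (descents σ) ≤_) (sym n∸1≡1+M) (perms-turns-≤ n≡2+M σ∈ true)))))

  peaksL∈range : ∀ {σ} → σ ∈ perms n → peaksL σ ∈ range 0 (n / 2)
  peaksL∈range {σ} σ∈ = subst (_∈ range 0 (n / 2)) (sym (perms-peaksL n≡2+M σ∈))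
    (∈-range z≤n (double-≤⇒≤/2 (ℕ.≤-trans (double-⌊/2⌋-≤ _)
      (subst (suc (turns false (descents σ)) ≤_) (sym n≡2+M) (s≤s (perms-turns-≤ n≡2+M σ∈ false))))))

  -- For an odd number of runs the second component of `runsC` is the true direction, so `W⁺` and
  -- `W⁻` can be read from it.
  odd-runs-direction : ∀ {r k} b → odd k ≡ true → (r ≡ᵇ k) ≡ true → not (odd r) ∨ b ≡ b
  odd-runs-direction {r} {k} b k-odd e rewrite ≡ᵇ-sound r k e | k-odd = refl

  genC⇒runsC : ∀ {x} → InSpan n (genC n) x → FunctionOf runsC x
  genC⇒runsC = InSpan⇒FunctionOf n (genC n) λ y y∈ →
    generator (∈-++⁻ (map (λ k → W (2 ℕ.* k)) (range 1 ((n ∸ 1) / 2))) y∈)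
    where
    odd-2*∸1 : ∀ {k} → 1 ≤ k → odd (2 ℕ.* k ∸ 1) ≡ true
    odd-2*∸1 {suc k} _ = trans (cong (λ t → odd (t ∸ 1)) (2*≡double (suc k))) (cong not (odd-double k))
    signed : ∀ {y} → (∃ λ k → k ∈ range 1 (n / 2) × y ∈ W⁺ (2 ℕ.* k ∸ 1) ∷ W⁻ (2 ℕ.* k ∸ 1) ∷ []) → FunctionOf runsC y
    signed (k , k∈ , here refl) = (λ (r , b) → bit ((r ≡ᵇ 2 ℕ.* k ∸ 1) ∧ b)) , λ σ _ →
      cong bit (∧-congˡ (λ e → sym (odd-runs-direction {run σ} (firstAsc σ) (odd-2*∸1 (range-≥ k∈)) e)))
    signed (k , k∈ , there (here refl)) = (λ (r , b) → bit ((r ≡ᵇ 2 ℕ.* k ∸ 1) ∧ not b)) , λ σ _ →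
      cong bit (∧-congˡ (λ e → cong not (sym (odd-runs-direction {run σ} (firstAsc σ) (odd-2*∸1 (range-≥ k∈)) e))))
    unsigned : ∀ {y} → (∃ λ k → k ∈ range 1 ((n ∸ 1) / 2) × y ≡ W (2 ℕ.* k)) → FunctionOf runsC y
    unsigned (k , _ , refl) = (λ (r , _) → bit (r ≡ᵇ 2 ℕ.* k)) , λ _ _ → refl
    generator : ∀ {y} → _ ⊎ _ → FunctionOf runsC y
    generator (inj₁ y∈) = unsigned (∈-map⁻ _ y∈)
    generator (inj₂ y∈) = signed (find (∈-concatMap⁻ _ y∈))

  runsC⇒genC : ∀ {x} → FunctionOf runsC x → InSpan n (genC n) x
  runsC⇒genC = FunctionOf⇒InSpan n eqRuns eqRuns-refl eqRuns-sound (genC n) λ σ σ∈ →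
    class (run σ) (firstAsc σ) (perms-run-≥ n≡2+M σ∈) (perms-run-≤ n≡2+M σ∈)
    where
    -- The number of runs is 2(k + 1) - 1, so the index is `suc k`; that it is at most `n − 1` says
    -- 2(k + 1) ≤ n.
    ∈odd : ∀ k {y} → suc (double k) ≤ suc M → y ∈ W⁺ (suc (double k)) ∷ W⁻ (suc (double k)) ∷ [] → y ∈ genC n
    ∈odd k {y} le y∈ = ∈-++⁺ʳ _ (∈-concatMap⁺ _ (lose
      (∈-range {x = suc k} (s≤s z≤n) (double-≤⇒≤/2 (subst (_ ≤_) (sym n≡2+M) (s≤s le))))
      (subst (λ r → y ∈ W⁺ (r ∸ 1) ∷ W⁻ (r ∸ 1) ∷ []) (sym (2*≡double (suc k))) y∈)))
    class : ∀ r b → 1 ≤ r → r ≤ suc M → ∃ λ y → y ∈ genC n ×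
            (∀ τ → τ ∈ perms n → y τ ≡ bit (eqRuns (runsC τ) (r , not (odd r) ∨ b)))
    class r b r≥1 r≤N with halfView r
    class _ b r≥1 r≤N | isEven (suc k) = W (double (suc k)) ,
      ∈-++⁺ˡ (subst (λ r → W r ∈ map (λ k → W (2 ℕ.* k)) (range 1 ((n ∸ 1) / 2))) (2*≡double (suc k))
        (∈-map⁺ (λ k → W (2 ℕ.* k)) (∈-range {x = suc k} (s≤s z≤n)
          (double-≤⇒≤/2 (subst (double (suc k) ≤_) (sym n∸1≡1+M) r≤N))))) ,
      λ τ _ → cong bit (indicator (run τ) (firstAsc τ))
      where
      indicator : ∀ t c → (t ≡ᵇ double (suc k))
        ≡ eqRuns (t , not (odd t) ∨ c) (double (suc k) , not (odd (double (suc k))) ∨ b)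
      indicator t c with t ≡ᵇ double (suc k) in e
      ... | false = refl
      ... | true rewrite ≡ᵇ-sound t (double (suc k)) e | odd-double k = refl
    class _ b r≥1 r≤N | isOdd k rewrite odd-double k with b
    ... | true  = W⁺ (suc (double k)) , ∈odd k r≤N (here refl) , λ τ _ →
      cong bit (∧-congˡ (λ e → sym (odd-runs-direction {run τ} (firstAsc τ) (cong not (odd-double k)) e)))
    ... | false = W⁻ (suc (double k)) , ∈odd k r≤N (there (here refl)) , λ τ _ →
      cong bit (∧-congˡ (λ e → cong not (sym (odd-runs-direction {run τ} (firstAsc τ) (cong not (odd-double k)) e))))

  subalgebras : SubalgebraOf n (genW± n) (genD n)
    × SubalgebraOf n (genW n) (genW± n)
    × SubalgebraOf n (genW° n) (genW± n)
    × SubalgebraOf n (genC n) (genW± n)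
    × SubalgebraOf n (genP n) (genW± n)
    × SubalgebraOf n (genP° n) (genW± n)
  subalgebras =
    subalgebra (genW± n) (genD n) genW±⇒runs± runs±⇒genW± runs±⇒descents descents⇒genD runs±-closed ,
    subalgebra (genW n) (genW± n) (genMap⇒ run (range 1 (n ∸ 1))) (⇒genMap run (range 1 (n ∸ 1)) run∈range)
      (FunctionOf-factor n proj₁ (λ _ _ → refl)) runs±⇒genW± run-closed ,
    subalgebra (genW° n) (genW± n) (genMap⇒ runL (range 1 n)) (⇒genMap runL (range 1 n) runL∈range)
      (FunctionOf-factor n (λ (r , b) → suc (turnsFrom r b false)) (λ σ σ∈ →
        trans (perms-runL n≡2+M σ∈) (cong suc (perms-turns-run n≡2+M σ∈ false)))) runs±⇒genW± runL-closed ,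
    subalgebra (genC n) (genW± n) genC⇒runsC runsC⇒genC
      (FunctionOf-factor n (λ (r , b) → r , not (odd r) ∨ b) (λ _ _ → refl)) runs±⇒genW± runsC-closed ,
    subalgebra (genP n) (genW± n) (genMap⇒ peaks (range 0 ((n ∸ 1) / 2))) (⇒genMap peaks (range 0 ((n ∸ 1) / 2)) peaks∈range)
      (FunctionOf-factor n (λ (r , b) → ⌊ turnsFrom r b true /2⌋) (λ σ σ∈ →
        trans (perms-peaks {n} σ∈) (cong ⌊_/2⌋ (perms-turns-run n≡2+M σ∈ true)))) runs±⇒genW± peaks-closed ,
    subalgebra (genP° n) (genW± n) (genMap⇒ peaksL (range 0 (n / 2))) (⇒genMap peaksL (range 0 (n / 2)) peaksL∈range)
      (FunctionOf-factor n (λ (r , b) → ⌊ suc (turnsFrom r b false) /2⌋) (λ σ σ∈ →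
        trans (perms-peaksL n≡2+M σ∈) (cong (λ t → ⌊ suc t /2⌋) (perms-turns-run n≡2+M σ∈ false)))) runs±⇒genW± peaksL-closed

theorem3p2 : (n : ℕ) → 2 ≤ n →
    SubalgebraOf n (genW± n) (genD n)
    × SubalgebraOf n (genW n) (genW± n)
    × SubalgebraOf n (genW° n) (genW± n)
    × SubalgebraOf n (genC n) (genW± n)
    × SubalgebraOf n (genP n) (genW± n)
    × SubalgebraOf n (genP° n) (genW± n)
theorem3p2 n 2≤n = Subalgebras.subalgebras {n} {n ∸ 2} (sym (ℕ.m+[n∸m]≡n 2≤n))
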